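{- Let $(\mathcal{R},\leq,r)$ be a \textbf{wA2}-space such that $\mathcal{AR}$ is countable. Then: (1) Every analytic subset of $\mathcal{R}$ is Kastanas Ramsey. (2) If every coanalytic subset of $\mathcal{R}\times2^\omega$ is Kastanas Ramsey, then every $\mathbf{\Sigma}^1_2$ subset of $\mathcal{R}$ is Kastanas Ramsey. More generally, for every $n\ge1$, if every $\mathbf{\Pi}^1_n$ subset of $\mathcal{R}\times2^\omega$ is Kastanas Ramsey, then every $\mathbf{\Sigma}^1_{n+1}$ subset of $\mathcal{R}$ is Kastanas Ramsey.
   Context: $\mathcal{R}$ nonempty, $\le$ quasi-order on $\mathcal{R}$, $r:\mathcal{R}\times\omega\to\mathcal{AR}$, $r_n(A):=r(A,n)$, $\mathcal{AR}_n$ the image of $r_n$. A1: (1) $r_0(A)=\emptyset$; (2) $A\ne B\Rightarrow r_n(A)\ne r_n(B)$ for some $n$; (3) $r_n(A)=r_m(B)\Rightarrow n=m$ and $r_k(A)=r_k(B)$ for $k<n$. $\mathrm{lh}(a)$: the $n$ with $a\in\mathcal{AR}_n$; $a\sqsubseteq b$ iff $a=r_m(A)$, $b=r_n(A)$ for some $A$, $m\le n$. wA2: a quasi-order $\leq_{\mathrm{fin}}$ on $\mathcal{AR}$ with (w1) $\{a:a\leq_{\mathrm{fin}}b\}$ countable; (2) $A\le B$ iff $\forall n\exists m\ r_n(A)\leq_{\mathrm{fin}}r_m(B)$; (3) $a\sqsubseteq b\leq_{\mathrm{fin}}c\Rightarrow\exists d\sqsubseteq c\ a\leq_{\mathrm{fin}}d$.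 $[a,A]=\{B\le A:\exists n\ r_n(B)=a\}$; $[n,A]=[r_n(A),A]$; $\mathrm{depth}_B(a)=\min\{n:a\leq_{\mathrm{fin}}r_n(B)\}$ or $\infty$; $\mathcal{AR}{\upharpoonright}A=\{a:\exists n\ a\leq_{\mathrm{fin}}r_n(A)\}$; $r_n[a,A]=\{b\in\mathcal{AR}{\upharpoonright}A:a\sqsubseteq b,\mathrm{lh}(b)=n\}$. A3: (1) $\mathrm{depth}_B(a)<\infty\Rightarrow[a,A]\ne\emptyset$ for all $A\in[\mathrm{depth}_B(a),B]$; (2) $A\le B$, $[a,A]\ne\emptyset\Rightarrow\exists A'\in[\mathrm{depth}_B(a),B]$ with $\emptyset\ne[a,A']\subseteq[a,A]$. A \textbf{wA2}-space: A1, wA2, A3 hold and $\mathcal{R}$ (identified with $\{(r_n(A))_n\}$) is closed in $\mathcal{AR}^{\mathbb N}$. Topology: first-difference metric $d(A,B)=2^{ -n}$, $n$ least with $r_n(A)\ne r_n(B)$ (Polish when $\mathcal{AR}$ is countable); $\mathcal{R}\times2^\omega$ carries the product topology. The \textbf{wA2}-space $(\mathcal{R}\times2^\omega,\preceq,r)$: approximations $\bigcup_n\mathcal{AR}_n\times2^n$; $r_n(A,u):=(r_n(A),u{\upharpoonright}n)$; $(a,p)\preceq_{\mathrm{fin}}(b,q)$ iff $a\leq_{\mathrm{fin}}b$; $(A,u)\preceq(B,v)$ iff $\forall n\exists m\ r_n(A,u)\preceq_{\mathrm{fin}}r_m(B,v)$. Kastanas Ramsey subsets of $\mathcal{R}\times2^\omega$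 refer to this space. Kastanas game $K[a,A]$: with $a_0=a$, $B_{ -1}=A$, in round $n\ge0$ I plays $A_n\in[a_n,B_{n-1}]$, then II plays $a_{n+1}\in r_{\mathrm{lh}(a_n)+1}[a_n,A_n]$ and $B_n\in[a_{n+1},A_n]$; outcome: the element $B$ with $r_{\mathrm{lh}(a)+n}(B)=a_n$ for all $n$. $\mathcal{X}$ is Kastanas Ramsey if for all $A$ and $a\in\mathcal{AR}{\upharpoonright}A$ there is $B\in[a,A]$ such that I has a strategy in $K[a,B]$ ensuring the outcome lies in $\mathcal{X}^c$, or II has a strategy in $K[a,B]$ ensuring the outcome lies in $\mathcal{X}$. -}

module Defs where

open import Data.Nat using (ℕ; zero; suc; _+_; _≤_; _<_)
open import Data.Bool using (Bool)
open import Data.Vec using (Vec; tabulate)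
open import Data.Fin using (toℕ)
open import Data.List using (List; map; upTo)
open import Data.Product using (Σ; ∃; _×_; _,_; proj₁; proj₂)
open import Data.Sum using (_⊎_)
open import Relation.Nullary using (¬_)
open import Relation.Binary.PropositionalEquality using (_≡_; _≢_)
open import Function.Definitions using (Injective)

record WA2Data : Set₁ where
  field
    R     : Set
    AR    : Set
    _≤R_  : R → R → Set
    r     : R → ℕ → AR
    _≤fin_ : AR → AR → Set

module Notions (D : WA2Data) where
  open WA2Data D

  InAR : ℕ → AR → Set
  InAR n a = ∃ λ A → r A n ≡ a

  _⊑_ : AR → AR → Set
  a ⊑ b = ∃ λ A → ∃ λ m → ∃ λ n → m ≤ n × r A m ≡ a × r A n ≡ b

  Cube : AR → R → R → Set
  Cube a A B = (B ≤R A) × (∃ λ n → r B n ≡ a)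

  CubeN : ℕ → R → R → Set
  CubeN n A = Cube (r A n) A

  ARup : R → AR → Set
  ARup A a = (∃ λ n → InAR n a) × (∃ λ n → a ≤fin r A n)

  IsDepth : R → AR → ℕ → Set
  IsDepth B a n = (a ≤fin r B n) × (∀ m → a ≤fin r B m → n ≤ m)

  -- b ∈ r_{lh(a)+1}[a , A]
  NextApprox : AR → R → AR → Set
  NextApprox a A b =
    ARup A b × a ⊑ b × (∃ λ k → InAR k a × InAR (suc k) b)

  -- The Kastanas game K[a , A].
  -- A play is given by I's moves  Is n = A_n  and II's moves
  -- IIs n = (a_{n+1} , B_n).

  module Play (a : AR) (A : R) (Is : ℕ → R) (IIs : ℕ → AR × R) where
    as : ℕ → AR
    as zero    = a
    as (suc n) = proj₁ (IIs n)

    Bprev : ℕ → R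
    Bprev zero    = A
    Bprev (suc n) = proj₂ (IIs n)

    LegalI : ℕ → Set
    LegalI n = Cube (as n) (Bprev n) (Is n)

    LegalII : ℕ → Set
    LegalII n = NextApprox (as n) (Is n) (proj₁ (IIs n))
              × Cube (proj₁ (IIs n)) (Is n) (proj₂ (IIs n))

    Outcome : R → Set
    Outcome B = ∃ λ k → InAR k a × (∀ n → r B (k + n) ≡ as n)

  prefix : {X : Set} → (ℕ → X) → ℕ → List X
  prefix f n = map f (upTo n)

  IWins : (R → Set) → AR → R → (List (AR × R) → R) → Set
  IWins Y a A σ = ∀ (τ : ℕ → AR × R) →
    let open Play a A (λ n → σ (prefix τ n)) τ in
      (∀ n → (∀ m → m < n → LegalII m) → LegalI n)
    × ((∀ n → LegalII n) → ∀ B → Outcome B → Y B)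

  IIWins : (R → Set) → AR → R → (List R → AR × R) → Set
  IIWins Y a A ρ = ∀ (α : ℕ → R) →
    let open Play a A α (λ n → ρ (prefix α (suc n))) in
      (∀ n → (∀ m → m ≤ n → LegalI m) → LegalII n)
    × ((∀ n → LegalI n) → ∀ B → Outcome B → Y B)

  KastanasRamsey : (R → Set) → Set
  KastanasRamsey X = ∀ A a → ARup A a →
    ∃ λ B → Cube a A B ×
      ((∃ λ σ → IWins (λ C → ¬ X C) a B σ) ⊎ (∃ λ ρ → IIWins X a B ρ))

record IsWA2 (D : WA2Data) : Set where
  open WA2Data D
  open Notions D
  field
    nonempty   : R
    ≤-refl     : ∀ A → A ≤R A
    ≤-trans    : ∀ A B C → A ≤R B → B ≤R C → A ≤R C
    ≤fin-refl  : ∀ a → a ≤fin a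
    ≤fin-trans : ∀ a b c → a ≤fin b → b ≤fin c → a ≤fin c
    AR-approx  : ∀ a → ∃ λ n → InAR n a
    A1-1 : ∀ A B → r A 0 ≡ r B 0          -- r_0(A) = ∅ for all A
    A1-2 : ∀ A B → A ≢ B → ∃ λ n → r A n ≢ r B n
    A1-3 : ∀ A B n m → r A n ≡ r B m → (n ≡ m) × (∀ k → k < n → r A k ≡ r B k)
    w1   : ∀ b → ∃ λ (g : AR → ℕ) →
             ∀ a a' → a ≤fin b → a' ≤fin b → g a ≡ g a' → a ≡ a'
    wA2-2 : ∀ A B → (A ≤R B → ∀ n → ∃ λ m → r A n ≤fin r B m)
                  × ((∀ n → ∃ λ m → r A n ≤fin r B m) → A ≤R B)
    wA2-3 : ∀ a b c → a ⊑ b → b ≤fin c → ∃ λ d → d ⊑ c × a ≤fin d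
    A3-1 : ∀ a B n → IsDepth B a n → ∀ A → CubeN n B A → ∃ λ C → Cube a A C
    A3-2 : ∀ a A B → A ≤R B → (∃ λ C → Cube a A C) → ∀ n → IsDepth B a n →
             ∃ λ A' → CubeN n B A' × (∃ λ C → Cube a A' C)
                    × (∀ C → Cube a A' C → Cube a A C)
    closed : ∀ (s : ℕ → AR) → (∀ n → ∃ λ A → ∀ k → k < n → r A k ≡ s k) →
             ∃ λ A → ∀ n → r A n ≡ s n

Countable : Set → Set
Countable X = Σ (X → ℕ) Injective′
  where Injective′ = λ f → ∀ {x y} → f x ≡ f y → x ≡ y

restrict : (ℕ → Bool) → (n : ℕ) → Vec Bool n
restrict u n = tabulate (λ i → u (toℕ i))

prodData : WA2Data → WA2Data
prodData D = record
  { R      = R × (ℕ → Bool)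
  ; AR     = Σ ℕ (λ n → AR × Vec Bool n)
  ; _≤R_   = λ x y → ∀ n → ∃ λ m → ≤f (r′ x n) (r′ y m)
  ; r      = r′
  ; _≤fin_ = ≤f
  }
  where
    open WA2Data D
    r′ : R × (ℕ → Bool) → ℕ → Σ ℕ (λ n → AR × Vec Bool n)
    r′ (A , u) n = n , r A n , restrict u n
    ≤f : Σ ℕ (λ n → AR × Vec Bool n) → Σ ℕ (λ n → AR × Vec Bool n) → Set
    ≤f (_ , a , _) (_ , b , _) = a ≤fin b

-- Topology (first-difference metric) and the projective hierarchy.
-- A "space" is a type with the basic neighbourhood relations
-- Nbhd n x y  ("x and y agree up to level n").

record Space : Set₁ where
  field
    Pt   : Set
    Nbhd : ℕ → Pt → Pt → Set

spaceOf : WA2Data → Space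
spaceOf D = record { Pt = WA2Data.R D ; Nbhd = λ n A B → WA2Data.r D A n ≡ WA2Data.r D B n }

_×Baire : Space → Space
S ×Baire = record
  { Pt   = Space.Pt S × (ℕ → ℕ)
  ; Nbhd = λ n p q → Space.Nbhd S n (proj₁ p) (proj₁ q)
                   × (∀ i → i < n → proj₂ p i ≡ proj₂ q i) }

Closed : (S : Space) → (Space.Pt S → Set) → Set
Closed S C = ∀ p → ¬ C p → ∃ λ n → ∀ q → Space.Nbhd S n p q → ¬ C q

-- Sigma n S P  :  P is Σ¹_{n+1} in S
-- Pi    n S P  :  P is Π¹_{n+1} in S
Sigma : ℕ → (S : Space) → (Space.Pt S → Set) → Set₁
Pi    : ℕ → (S : Space) → (Space.Pt S → Set) → Set₁

Sigma zero S P = ∃ λ (C : Space.Pt (S ×Baire) → Set) → Closed (S ×Baire) C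
  × (∀ x → (P x → ∃ λ y → C (x , y)) × ((∃ λ y → C (x , y)) → P x))
Sigma (suc n) S P = ∃ λ (C : Space.Pt (S ×Baire) → Set) → Pi n (S ×Baire) C
  × (∀ x → (P x → ∃ λ y → C (x , y)) × ((∃ λ y → C (x , y)) → P x))

Pi n S P = ∃ λ (Q : Space.Pt S → Set) → Sigma n S Q
  × (∀ x → (P x → ¬ Q x) × (¬ Q x → P x))

Analytic : (S : Space) → (Space.Pt S → Set) → Set₁
Analytic = Sigma zero

{-# OPTIONS --safe #-}
module Submission where

-- A Σ¹ subset X of R is the projection of a subset C of R × ω^ω, and y ∈ ω^ω is
-- coded by a set of pairs u ∈ 2^ω containing all (i , y i). So X is also the
-- projection of a set Y ⊆ R × 2^ω; Y is Gδ if C is closed, and Π¹ₙ if C is.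
-- If Y is Kastanas Ramsey then so is X: a strategy of II just forgets the bits of u,
-- while I can play against all bit choices at once, as only finitely many bit
-- strings are relevant in each round.
-- Gδ games are determined: II has to meet countably many obligations, and
-- either I can trap the play, inductively, before some obligation, or II can
-- reach each obligation at a position from which I still cannot trap the play.

open import Defs
open import Data.Nat using (ℕ; zero; suc; _+_; _*_; _≤_; _<_; z≤n; s≤s; _≟_; _<?_; _⊔_)
open import Data.Nat.Properties
open import Data.Bool using (Bool; true; false; T)
open import Data.Fin using (toℕ; fromℕ<)
open import Data.Fin.Properties using (toℕ<n; toℕ-fromℕ<)
open import Data.List using (List; []; _∷_; _∷ʳ_; map; foldl; upTo)
open import Data.List.Properties using (upTo-∷ʳ; map-++; foldl-∷ʳ)
open import Data.List.Membership.Propositional using (_∈_)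
open import Data.List.Relation.Unary.All as All using (All; []; _∷_)
open import Data.List.Relation.Unary.Any using (here; there)
open import Data.Vec using (Vec; []; _∷_; lookup)
open import Data.Vec.Properties using (tabulate-cong; lookup∘tabulate)
open import Data.Product using (Σ; ∃; _×_; _,_; proj₁; proj₂)
open import Data.Sum using (_⊎_; inj₁; inj₂; [_,_]′)
open import Data.Empty using (⊥; ⊥-elim)
open import Function using (_∘_)
open import Relation.Binary using (tri<; tri≈; tri>)
open import Relation.Binary.PropositionalEquality
open import Relation.Nullary using (¬_; Dec; yes; no; does)
open import Relation.Nullary.Decidable
  using (⌊_⌋; toWitness; fromWitness; decidable-stable; dec-true; dec-false)

-- Strategies as machines

-- The set Y is chosen only after the approximation a is known: a position of length `k` in the
-- product game has already fixed `k` bits, so the coding skips these bits, and the threads of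
-- player I grow from a single initial string. For analytic X there is no search for a good B: the
-- Gδ game is determined from every position, so any element of [a,A] serves. In the projective case
-- B is the one supplied by the Kastanas Ramsey property of Y. Excluded middle is available for
-- `Set` only, whereas strategies bundled with their memory types live in `Set₁`. Determinacy
-- therefore splits on the inductive predicate `Trapped`, and memories are read off from derivations
-- of `Trapped` and `Reach`. Memory indexed by positions also makes each transfer of a strategy a
-- matter of a single round, with no histories to translate.

Agree : {X : Set} → ℕ → (ℕ → X) → (ℕ → X) → Set
Agree n f g = ∀ i → i < n → f i ≡ g i

Agree-≤ : {X : Set} {m n : ℕ} {f g : ℕ → X} → m ≤ n → Agree n f g → Agree m f g
Agree-≤ m≤n e i i<m = e i (≤-trans i<m m≤n)

Agree-sym : {X : Set} {n : ℕ} {f g : ℕ → X} → Agree n f g → Agree n g f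
Agree-sym e i i<n = sym (e i i<n)

update : {X : Set} → (ℕ → X) → ℕ → X → ℕ → X
update f n x i with i ≟ n
... | yes _ = x
... | no  _ = f i

update-at : {X : Set} (f : ℕ → X) (n : ℕ) (x : X) → update f n x n ≡ x
update-at f n x with n ≟ n
... | yes _  = refl
... | no n≢n = ⊥-elim (n≢n refl)

update-below : {X : Set} (f : ℕ → X) (n : ℕ) (x : X) → Agree n (update f n x) f
update-below f n x i i<n with i ≟ n
... | yes refl = ⊥-elim (<-irrefl refl i<n)
... | no _     = refl

<-suc-cases : {m n : ℕ} → m < suc n → m < n ⊎ m ≡ n
<-suc-cases m<1+n = m≤n⇒m<n∨m≡n (≤-pred m<1+n)

module Game (lem : (P : Set) → Dec P) (D : WA2Data) where
  open WA2Data D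
  open Notions D

  prefix-suc : {X : Set} (f : ℕ → X) (n : ℕ) → prefix f (suc n) ≡ prefix f n ∷ʳ f n
  prefix-suc f n = trans (cong (map f) (sym (upTo-∷ʳ n))) (map-++ f (upTo n) (n ∷ []))

  prefix-cong : {X : Set} {f g : ℕ → X} (n : ℕ) → Agree n f g → prefix f n ≡ prefix g n
  prefix-cong zero _ = refl
  prefix-cong {f = f} {g} (suc n) e = begin
    prefix f (suc n)     ≡⟨ prefix-suc f n ⟩
    prefix f n ∷ʳ f n    ≡⟨ cong₂ _∷ʳ_ (prefix-cong n (Agree-≤ (n≤1+n n) e)) (e n ≤-refl) ⟩
    prefix g n ∷ʳ g n    ≡⟨ prefix-suc g n ⟨
    prefix g (suc n)     ∎
    where open ≡-Reasoning

  Pos : Set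
  Pos = AR × R

  MoveI : Pos → R → Set
  MoveI (a , B) A = Cube a B A

  MoveII : Pos → R → Pos → Set
  MoveII (a , _) A (a′ , B′) = NextApprox a A a′ × Cube a′ A B′

  Outcome : (ℕ → Pos) → R → Set
  Outcome p B = ∃ λ k → InAR k (proj₁ (p 0)) × (∀ n → r B (k + n) ≡ proj₁ (p n))

  at : Pos → (ℕ → Pos) → ℕ → Pos
  at p τ zero    = p
  at p τ (suc n) = τ n

  at-cong : ∀ {p τ τ′} n → Agree n τ τ′ → at p τ n ≡ at p τ′ n
  at-cong zero    _ = refl
  at-cong (suc n) e = e n ≤-refl

  module _ {a : AR} {A : R} (α : ℕ → R) {τ : ℕ → Pos} where
    open Play a A α τ using (LegalI; LegalII; as)

    LegalI⇒MoveI : ∀ n → LegalI n → MoveI (at (a , A) τ n) (α n)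
    LegalI⇒MoveI zero    l = l
    LegalI⇒MoveI (suc n) l = l

    MoveI⇒LegalI : ∀ n → MoveI (at (a , A) τ n) (α n) → LegalI n
    MoveI⇒LegalI zero    l = l
    MoveI⇒LegalI (suc n) l = l

    LegalII⇒MoveII : ∀ n → LegalII n → MoveII (at (a , A) τ n) (α n) (τ n)
    LegalII⇒MoveII zero    l = l
    LegalII⇒MoveII (suc n) l = l

    MoveII⇒LegalII : ∀ n → MoveII (at (a , A) τ n) (α n) (τ n) → LegalII n
    MoveII⇒LegalII zero    l = l
    MoveII⇒LegalII (suc n) l = l

    as≡ : ∀ n → as n ≡ proj₁ (at (a , A) τ n)
    as≡ zero    = refl
    as≡ (suc n) = refl

  -- State p is the memory of a strategy at position p.
  record MachineI : Set₁ where
    field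
      State     : Pos → Set
      move      : ∀ {p} → State p → R
      move-legal : ∀ {p} (s : State p) → MoveI p (move s)
      next      : ∀ {p} (s : State p) (q : Pos) → MoveII p (move s) q → State q

    Config : Set
    Config = Σ Pos State

    data Step : Config → Config → Set where
      step : ∀ {p s} q l → Step (p , s) (q , next {p} s q l)

  record WinI (Y : R → Set) (p : Pos) : Set₁ where
    field
      machine : MachineI
    open MachineI machine public
    field
      start : State p
      wins  : ∀ run → run 0 ≡ (p , start) → (∀ n → Step (run n) (run (suc n))) →
              ∀ B → Outcome (proj₁ ∘ run) B → Y B

  record MachineII : Set₁ where
    field
      State   : Pos → Set
      respond : ∀ {p} (s : State p) (A : R) → MoveI p A → Σ Pos λ q → MoveII p A q × State q

    Config : Set
    Config = Σ Pos State

    data Step : Config → Config → Set where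
      step : ∀ {p s} A l → Step (p , s)
               (proj₁ (respond {p} s A l) , proj₂ (proj₂ (respond {p} s A l)))

  record WinII (Y : R → Set) (p : Pos) : Set₁ where
    field
      machine : MachineII
    open MachineII machine public
    field
      start : State p
      wins  : ∀ run → run 0 ≡ (p , start) → (∀ n → Step (run n) (run (suc n))) →
              ∀ B → Outcome (proj₁ ∘ run) B → Y B

  -- Machines and strategies on histories are interchangeable.

  module _ {Y : R → Set} {a : AR} {A : R} where

    WinI⇒strategy : WinI Y (a , A) → ∃ (IWins Y a A)
    WinI⇒strategy W = σ , λ τ → legal τ , won τ
      where
      open WinI W

      advance : Config → Pos → Config
      advance (p , s) q with lem (MoveII p (move s) q)
      ... | yes l = q , next s q l
      -- After an illegal move of II nothing is required of I, so this default never matters.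
      ... | no  _ = p , s

      advance-step : ∀ c q → MoveII (proj₁ c) (move (proj₂ c)) q →
                     Step c (advance c q) × proj₁ (advance c q) ≡ q
      advance-step (p , s) q l with lem (MoveII p (move s) q)
      ... | yes l′ = step q l′ , refl
      ... | no ¬l  = ⊥-elim (¬l l)

      after : List Pos → Config
      after = foldl advance ((a , A) , start)

      σ : List Pos → R
      σ h = move (proj₂ (after h))

      module _ (τ : ℕ → Pos) where
        replies : ℕ → R
        replies n = σ (prefix τ n)
        open Play a A replies τ using (LegalI; LegalII) renaming (Outcome to Outcome′)

        config : ℕ → Config
        config n = after (prefix τ n)

        config-suc : ∀ n → config (suc n) ≡ advance (config n) (τ n)
        config-suc n = trans (cong after (prefix-suc τ n))
                             (foldl-∷ʳ advance _ (τ n) (prefix τ n))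

        pos : ∀ n → (∀ m → m < n → LegalII m) → proj₁ (config n) ≡ at (a , A) τ n
        moveII : ∀ n → (∀ m → m ≤ n → LegalII m) →
                 MoveII (proj₁ (config n)) (move (proj₂ (config n))) (τ n)

        pos zero    _ = refl
        pos (suc n) l = trans (cong proj₁ (config-suc n))
          (proj₂ (advance-step (config n) (τ n) (moveII n (λ m m≤n → l m (s≤s m≤n)))))

        moveII n l = subst (λ p → MoveII p (move (proj₂ (config n))) (τ n))
          (sym (pos n (λ m m<n → l m (<⇒≤ m<n)))) (LegalII⇒MoveII replies n (l n ≤-refl))

        legal : ∀ n → (∀ m → m < n → LegalII m) → LegalI n
        legal n l = MoveI⇒LegalI replies n
          (subst (λ p → MoveI p (move (proj₂ (config n)))) (pos n l)
            (move-legal (proj₂ (config n))))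

        won : (∀ n → LegalII n) → ∀ B → Outcome′ B → Y B
        won l B (k , ka , out) = wins config refl
          (λ n → subst (Step (config n)) (sym (config-suc n))
            (proj₁ (advance-step (config n) (τ n) (moveII n (λ m _ → l m)))))
          B (k , ka , λ n → trans (out n)
            (trans (as≡ replies n) (cong proj₁ (sym (pos n (λ m _ → l m))))))

    strategy⇒WinI : ∃ (IWins Y a A) → WinI Y (a , A)
    strategy⇒WinI (σ , w) = record
      { machine = machine
      ; start = 0 , (λ _ → a , A) , (λ _ ()) , refl
      ; wins = won }
      where
      replies : (ℕ → Pos) → ℕ → R
      replies τ n = σ (prefix τ n)

      Legal : (ℕ → Pos) → ℕ → Set
      Legal τ m = MoveII (at (a , A) τ m) (σ (prefix τ m)) (τ m)

      Legal-cong : ∀ {τ τ′} m → Agree (suc m) τ τ′ → Legal τ m → Legal τ′ m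
      Legal-cong {τ} {τ′} m e l
        rewrite sym (at-cong {a , A} m (Agree-≤ (n≤1+n m) e))
              | sym (prefix-cong m (Agree-≤ (n≤1+n m) e))
              | sym (e m ≤-refl) = l

      -- The memory is the whole play so far. Only the first `n` values of `τ` count; a total
      -- sequence lets `prefix` be applied without transport.
      St : Pos → Set
      St p = Σ ℕ λ n → Σ (ℕ → Pos) λ τ → (∀ m → m < n → Legal τ m) × at (a , A) τ n ≡ p

      machine : MachineI
      machine = record
        { State = St
        ; move = λ (n , τ , _) → σ (prefix τ n)
        ; move-legal = λ { (n , τ , l , refl) →
            LegalI⇒MoveI (replies τ) n (proj₁ (w τ) n (λ m m<n → MoveII⇒LegalII (replies τ) m (l m m<n))) }
        ; next = λ { (n , τ , l , refl) q lq → suc n , update τ n q ,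
            (λ m m<1+n → extend n τ l q lq m (<-suc-cases m<1+n)) , update-at τ n q } }
        where
        extend : ∀ n τ → (∀ m → m < n → Legal τ m) → ∀ q →
                 MoveII (at (a , A) τ n) (σ (prefix τ n)) q →
                 ∀ m → m < n ⊎ m ≡ n → Legal (update τ n q) m
        extend n τ l q lq m (inj₁ m<n) =
          Legal-cong m (Agree-≤ m<n (Agree-sym (update-below τ n q))) (l m m<n)
        extend n τ l q lq m (inj₂ refl)
          rewrite at-cong {a , A} n (update-below τ n q)
                | prefix-cong n (update-below τ n q)
                | update-at τ n q = lq
      open MachineI machine

      won : ∀ run → run 0 ≡ ((a , A) , 0 , (λ _ → a , A) , (λ _ ()) , refl) →
            (∀ n → Step (run n) (run (suc n))) → ∀ B → Outcome (proj₁ ∘ run) B → Y B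
      won run run0 steps B (k , ka , out) =
        proj₂ (w τ) (λ n → MoveII⇒LegalII (replies τ) n (legal n)) B
          (k , subst (InAR k ∘ proj₁) (cong proj₁ run0) ka , λ n → trans (out n) (pos n))
        where
        τ : ℕ → Pos
        τ n = proj₁ (run (suc n))

        -- The run is an arbitrary chain of configurations, so it takes an induction to see that all
        -- memories along it record one and the same play `τ`.
        Inv : ℕ → Config → Set
        Inv n (_ , n′ , τ′ , _) = n′ ≡ n × Agree n τ′ τ

        Inv-suc : ∀ n {c c′} → Step c c′ → proj₁ c′ ≡ τ n → Inv n c → Inv (suc n) c′
        Inv-suc n (step {s = _ , τ′ , _ , refl} q l) q≡ (refl , e) = refl , λ i i<1+n →
          case-< i (<-suc-cases i<1+n)
          where
          case-< : ∀ i → i < n ⊎ i ≡ n → update τ′ n q i ≡ τ i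
          case-< i (inj₁ i<n)  = trans (update-below τ′ n q i i<n) (e i i<n)
          case-< i (inj₂ refl) = trans (update-at τ′ n q) q≡

        inv : ∀ n → Inv n (run n)
        inv zero    = subst (Inv 0) (sym run0) (refl , λ _ ())
        inv (suc n) = Inv-suc n (steps n) refl (inv n)

        Inv⇒legal : ∀ n c → Inv (suc n) c → Legal τ n
        Inv⇒legal n (_ , _ , _ , l , _) (refl , e) = Legal-cong n e (l n ≤-refl)

        legal : ∀ n → Legal τ n
        legal n = Inv⇒legal n (run (suc n)) (inv (suc n))

        pos : ∀ n → proj₁ (proj₁ (run n)) ≡ Play.as a A (λ n → σ (prefix τ n)) τ n
        pos zero    = cong (proj₁ ∘ proj₁) run0
        pos (suc n) = refl

    WinII⇒strategy : WinII Y (a , A) → ∃ (IIWins Y a A)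
    WinII⇒strategy W = ρ , λ α → legal α , won α
      where
      open WinII W

      advance : Config → R → Config
      advance (p , s) A with lem (MoveI p A)
      ... | yes l = proj₁ (respond s A l) , proj₂ (proj₂ (respond s A l))
      ... | no  _ = p , s

      advance-step : ∀ c A → MoveI (proj₁ c) A →
                     Step c (advance c A) × MoveII (proj₁ c) A (proj₁ (advance c A))
      advance-step (p , s) A l with lem (MoveI p A)
      ... | yes l′ = step A l′ , proj₁ (proj₂ (respond s A l′))
      ... | no ¬l  = ⊥-elim (¬l l)

      after : List R → Config
      after = foldl advance ((a , A) , start)

      ρ : List R → Pos
      ρ h = proj₁ (after h)

      module _ (α : ℕ → R) where
        τ : ℕ → Pos
        τ n = ρ (prefix α (suc n))
        open Play a A α τ using (LegalI; LegalII) renaming (Outcome to Outcome′)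

        config : ℕ → Config
        config n = after (prefix α n)

        config-suc : ∀ n → config (suc n) ≡ advance (config n) (α n)
        config-suc n = trans (cong after (prefix-suc α n))
                             (foldl-∷ʳ advance _ (α n) (prefix α n))

        pos : ∀ n → proj₁ (config n) ≡ at (a , A) τ n
        pos zero    = refl
        pos (suc n) = refl

        stepped : ∀ n → LegalI n → Step (config n) (config (suc n)) ×
                  MoveII (proj₁ (config n)) (α n) (proj₁ (config (suc n)))
        stepped n l = subst (λ c → Step (config n) c × MoveII (proj₁ (config n)) (α n) (proj₁ c))
          (sym (config-suc n))
          (advance-step (config n) (α n)
            (subst (λ p → MoveI p (α n)) (sym (pos n)) (LegalI⇒MoveI α n l)))

        legal : ∀ n → (∀ m → m ≤ n → LegalI m) → LegalII n
        legal n l = MoveII⇒LegalII α n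
          (subst (λ p → MoveII p (α n) (τ n)) (pos n) (proj₂ (stepped n (l n ≤-refl))))

        won : (∀ n → LegalI n) → ∀ B → Outcome′ B → Y B
        won l B (k , ka , out) = wins config refl (λ n → proj₁ (stepped n (l n))) B
          (k , ka , λ n → trans (out n) (trans (as≡ α n) (cong proj₁ (sym (pos n)))))

    strategy⇒WinII : ∃ (IIWins Y a A) → WinII Y (a , A)
    strategy⇒WinII (ρ , w) = record
      { machine = machine
      ; start = 0 , (λ _ → A) , (λ _ ()) , refl
      ; wins = won }
      where
      reply : (ℕ → R) → ℕ → Pos
      reply α n = ρ (prefix α (suc n))

      position : (ℕ → R) → ℕ → Pos
      position α = at (a , A) (reply α)

      position-cong : ∀ {α α′} n → Agree n α α′ → position α n ≡ position α′ n
      position-cong n e = at-cong n (λ i i<n → cong ρ (prefix-cong (suc i) (Agree-≤ i<n e)))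

      Legal : (ℕ → R) → ℕ → Set
      Legal α m = MoveI (position α m) (α m)

      Legal-cong : ∀ {α α′} m → Agree (suc m) α α′ → Legal α m → Legal α′ m
      Legal-cong {α} {α′} m e l
        rewrite sym (position-cong m (Agree-≤ (n≤1+n m) e))
              | sym (e m ≤-refl) = l

      St : Pos → Set
      St p = Σ ℕ λ n → Σ (ℕ → R) λ α → (∀ m → m < n → Legal α m) × position α n ≡ p

      extend : ∀ n α → (∀ m → m < n → Legal α m) → ∀ A′ → MoveI (position α n) A′ →
               ∀ m → m < n ⊎ m ≡ n → Legal (update α n A′) m
      extend n α l A′ lA m (inj₁ m<n) =
        Legal-cong m (Agree-≤ m<n (Agree-sym (update-below α n A′))) (l m m<n)
      extend n α l A′ lA m (inj₂ refl)
        rewrite position-cong n (update-below α n A′) | update-at α n A′ = lA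

      reply-legal : ∀ n α A′ → (∀ m → m ≤ n → Legal (update α n A′) m) →
                    MoveII (position α n) A′ (reply (update α n A′) n)
      reply-legal n α A′ l = subst₂ (λ p C → MoveII p C (reply (update α n A′) n))
        (position-cong n (update-below α n A′)) (update-at α n A′)
        (LegalII⇒MoveII (update α n A′) n
          (proj₁ (w (update α n A′)) n (λ m m≤n → MoveI⇒LegalI (update α n A′) m (l m m≤n))))

      machine : MachineII
      machine = record
        { State = St
        ; respond = λ { (n , α , l , refl) A′ lA →
            let l′ = λ m m<1+n → extend n α l A′ lA m (<-suc-cases m<1+n) in
            reply (update α n A′) n ,
            reply-legal n α A′ (λ m m≤n → l′ m (s≤s m≤n)) ,
            suc n , update α n A′ , l′ , refl } }
      open MachineII machine

      won : ∀ run → run 0 ≡ ((a , A) , 0 , (λ _ → A) , (λ _ ()) , refl) →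
            (∀ n → Step (run n) (run (suc n))) → ∀ B → Outcome (proj₁ ∘ run) B → Y B
      won run run0 steps B (k , ka , out) =
        proj₂ (w α) (λ n → MoveI⇒LegalI α n (legal n)) B
          (k , subst (InAR k ∘ proj₁) (cong proj₁ run0) ka ,
           λ n → trans (out n) (trans (cong proj₁ (Inv⇒pos n (run n) (inv n))) (sym (as≡ α n))))
        where
        moves : Config → ℕ → R
        moves (_ , _ , α′ , _) = α′

        α : ℕ → R
        -- Positions show only the moves of II; the move of I in round `n` is found in the memory
        -- one round later.
        α n = moves (run (suc n)) n

        Inv : ℕ → Config → Set
        Inv n (_ , n′ , α′ , _) = n′ ≡ n × Agree n α′ α

        Inv-suc : ∀ n {c c′} → Step c c′ → moves c′ n ≡ α n → Inv n c → Inv (suc n) c′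
        Inv-suc n (step {s = _ , α′ , _ , refl} A′ l) A≡ (refl , e) = refl , λ i i<1+n →
          case-< i (<-suc-cases i<1+n)
          where
          case-< : ∀ i → i < n ⊎ i ≡ n → update α′ n A′ i ≡ α i
          case-< i (inj₁ i<n)  = trans (update-below α′ n A′ i i<n) (e i i<n)
          case-< i (inj₂ refl) = A≡

        inv : ∀ n → Inv n (run n)
        inv zero    = subst (Inv 0) (sym run0) (refl , λ _ ())
        inv (suc n) = Inv-suc n (steps n) refl (inv n)

        Inv⇒legal : ∀ n c → Inv (suc n) c → Legal α n
        Inv⇒legal n (_ , _ , _ , l , _) (refl , e) = Legal-cong n e (l n ≤-refl)

        legal : ∀ n → Legal α n
        legal n = Inv⇒legal n (run (suc n)) (inv (suc n))

        Inv⇒pos : ∀ n c → Inv n c → proj₁ c ≡ position α n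
        Inv⇒pos n (_ , _ , _ , _ , refl) (refl , e) = position-cong n e

  -- Determinacy of games with countably many obligations.

  module Determinacy (U : ℕ → AR → Set) where

    -- Trapped i p: from p, player I can prevent the obligations U i, U (i+1), …
    -- from all being met one after the other. The set Z is invariant as long as
    -- U i is not met; it is Bool-valued to keep Trapped in Set, where lem applies.
    data Trapped : ℕ → Pos → Set where
      trap : ∀ {i p} (Z : Pos → Bool) → T (Z p) → (A : ∀ q → T (Z q) → R) →
             (∀ q z → MoveI q (A q z)) →
             (∀ q z q′ → MoveII q (A q z) q′ → U i (proj₁ q′) → Trapped (suc i) q′) →
             (∀ q z q′ → MoveII q (A q z) q′ → ¬ U i (proj₁ q′) → T (Z q′)) →
             Trapped i p

    Good : ℕ → Pos → Set
    Good i q = U i (proj₁ q) × ¬ Trapped (suc i) q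

    -- Well-founded trees: whatever I plays, II arrives at a `Good i` position after finitely many
    -- rounds. The replies `Q` are stored as a function, so a derivation is itself a strategy for
    -- this stage.
    data Reach (i : ℕ) : Pos → Set where
      reach : ∀ {p} (Q : ∀ A → MoveI p A → Pos) →
              (∀ A l → MoveII p A (Q A l)) →
              (∀ A l → ¬ Good i (Q A l) → Reach i (Q A l)) →
              Reach i p

    -- The positions without `Reach i` are an invariant set for I: from each of them some move
    -- leaves II only replies that are neither `Good i` nor in `Reach i`. A reply that meets `U i`
    -- without being `Good i` is trapped at the next stage; any other reply stays in the set.
    ¬Trapped⇒Reach : ∀ {i p} → ¬ Trapped i p → Reach i p
    ¬Trapped⇒Reach {i} {p} ¬w = decidable-stable (lem _) λ ¬reach →
      ¬w (trap (λ q → ⌊ lem (¬ Reach i q) ⌋) (fromWitness ¬reach)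
        (λ q z → proj₁ (escape q (toWitness z)))
        (λ q z → proj₁ (proj₂ (escape q (toWitness z))))
        (λ q z q′ l u → decidable-stable (lem _) λ ¬w′ →
          proj₂ (proj₂ (escape q (toWitness z))) q′ l (λ ¬good → ⊥-elim (¬good (u , ¬w′))))
        (λ q z q′ l ¬u → fromWitness λ reach′ →
          proj₂ (proj₂ (escape q (toWitness z))) q′ l (λ _ → reach′)))
      where
      escape : ∀ q → ¬ Reach i q →
               ∃ λ A → MoveI q A × (∀ q′ → MoveII q A q′ → ¬ (¬ Good i q′ → Reach i q′))
      escape q ¬reach = decidable-stable (lem _) λ none →
        -- Excluded middle for a Σ-type returns a witness, so it also chooses the replies that form
        -- `Q`.
        let answer = λ A l → decidable-stable
              (lem (Σ Pos λ q′ → MoveII q A q′ × (¬ Good i q′ → Reach i q′)))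
              (λ no-answer → none (A , l , λ q′ l′ c → no-answer (q′ , l′ , c)))
        in ¬reach (reach (λ A l → proj₁ (answer A l))
                         (λ A l → proj₁ (proj₂ (answer A l)))
                         (λ A l → proj₂ (proj₂ (answer A l))))

    module _ {Y : R → Set} {p : Pos} where

      -- I stays in a trap until its obligation is met and then passes to the subderivation given by
      -- `hit`. A play in `Y` would meet every obligation again and again, forcing an infinite
      -- descent through a well-founded derivation. Arbitrarily late visits are required because
      -- early ones may precede the entry into the trap for `i`.
      Trapped⇒WinI : Trapped 0 p →
        (∀ B k → InAR k (proj₁ p) → Y B → ∀ i m → ∃ λ n → m ≤ n × U i (r B (k + n))) →
        WinI (λ B → ¬ Y B) p
      Trapped⇒WinI w Y⇒ = record { machine = machine ; start = 0 , w ; wins = wins }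
        where
        machine : MachineI
        machine = record
          { State = λ q → ∃ λ i → Trapped i q
          ; move = λ { {q} (_ , trap Z z A _ _ _) → A q z }
          ; move-legal = λ { {q} (_ , trap Z z A l _ _) → l q z }
          ; next = λ { {q} (i , trap Z z A l hit miss) q′ l′ →
              proceed (lem (U i (proj₁ q′)))
                (hit q z q′ l′) (λ ¬u → trap Z (miss q z q′ l′ ¬u) A l hit miss) } }
          where
          proceed : ∀ {i q′} → Dec (U i (proj₁ q′)) → (U i (proj₁ q′) → Trapped (suc i) q′) →
                    (¬ U i (proj₁ q′) → Trapped i q′) → ∃ λ i′ → Trapped i′ q′
          proceed (yes u) hit _    = _ , hit u
          proceed (no ¬u) _   miss = _ , miss ¬u
        open MachineI machine using (Step; step)

        after-step : ∀ {q i Z z A l hit miss c} → Step (q , i , trap Z z A l hit miss) c →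
          (∃ λ l′ → ∃ λ u → c ≡ (proj₁ c , suc i , hit q z (proj₁ c) l′ u)) ⊎
          (¬ U i (proj₁ (proj₁ c)) × ∃ λ z′ → c ≡ (proj₁ c , i , trap Z z′ A l hit miss))
        after-step {i = i} (step q′ l′) with lem (U i (proj₁ q′))
        ... | yes u = inj₁ (l′ , u , refl)
        ... | no ¬u = inj₂ (¬u , _ , refl)

        wins : ∀ run → run 0 ≡ (p , 0 , w) → (∀ n → Step (run n) (run (suc n))) →
               ∀ B → Outcome (proj₁ ∘ run) B → ¬ Y B
        wins run run0 steps B (k , ka , out) y = lost w 0 run0
          where
          recurs : ∀ i m → ∃ λ n → m ≤ n × U i (proj₁ (proj₁ (run n)))
          recurs i m with Y⇒ B k (subst (InAR k ∘ proj₁ ∘ proj₁) run0 ka) y i m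
          ... | n , m≤n , u = n , m≤n , subst (U i) (out n) u

          lost : ∀ {i q} (w : Trapped i q) n → run n ≡ (q , i , w) → ⊥
          lost {i} (trap Z z A l hit miss) n e with recurs i (suc n)
          ... | n′ , n<n′ , u with m≤n⇒∃[o]m+o≡n n<n′
          ... | d , refl = go d z n e u
            where
            -- `d` counts the rounds left until the known visit to `U i`: it decreases inside one
            -- trap, while a change of trap descends in `Trapped`.
            go : ∀ d {q} z n → run n ≡ (q , i , trap Z z A l hit miss) →
                 U i (proj₁ (proj₁ (run (suc n + d)))) → ⊥
            go d z n e u with after-step (subst (λ c → Step c (run (suc n))) e (steps n))
            ... | inj₁ (l′ , u′ , e′) = lost (hit _ z _ l′ u′) (suc n) e′
            go zero z n e u | inj₂ (¬u , _) =
              ¬u (subst (λ m → U i (proj₁ (proj₁ (run m)))) (+-identityʳ (suc n)) u)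
            go (suc d) z n e u | inj₂ (_ , z′ , e′) = go d z′ (suc n) e′
              (subst (λ m → U i (proj₁ (proj₁ (run m)))) (+-suc (suc n) d) u)

      -- Every tree is left after finitely many rounds at a position that meets `U i` and is not
      -- trapped at stage `i + 1`, so the tree for the next stage exists there. This guarantees one
      -- visit per obligation, which is all that the second hypothesis asks for.
      Reach⇒WinII : Reach 0 p →
        (∀ B k → InAR k (proj₁ p) → (∀ i → ∃ λ n → U i (r B (k + n))) → Y B) →
        WinII Y p
      Reach⇒WinII reach₀ ⇒Y = record { machine = machine ; start = 0 , reach₀ ; wins = wins }
        where
        proceed : ∀ {i q′} → Dec (Good i q′) → (¬ Good i q′ → Reach i q′) → ∃ λ i′ → Reach i′ q′
        proceed {i} (yes (_ , ¬w)) _    = suc i , ¬Trapped⇒Reach ¬w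
        proceed {i} (no ¬good)     cont = i , cont ¬good

        machine : MachineII
        machine = record
          { State = λ q → ∃ λ i → Reach i q
          ; respond = λ { (i , reach Q l cont) A lA →
              Q A lA , l A lA , proceed (lem (Good i (Q A lA))) (cont A lA) } }
        open MachineII machine using (Step; step)

        after-step : ∀ {q i Q l cont c} → Step (q , i , reach Q l cont) c →
          (U i (proj₁ (proj₁ c)) × ∃ λ s → c ≡ (proj₁ c , suc i , s)) ⊎
          (∃ λ A → ∃ λ lA → ∃ λ ¬good → c ≡ (Q A lA , i , cont A lA ¬good))
        after-step {i = i} {Q} (step A lA) with lem (Good i (Q A lA))
        ... | yes (u , _) = inj₁ (u , _ , refl)
        ... | no ¬good    = inj₂ (A , lA , ¬good , refl)

        wins : ∀ run → run 0 ≡ (p , 0 , reach₀) → (∀ n → Step (run n) (run (suc n))) →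
               ∀ B → Outcome (proj₁ ∘ run) B → Y B
        wins run run0 steps B (k , ka , out) =
          ⇒Y B k (subst (InAR k ∘ proj₁ ∘ proj₁) run0 ka)
            (λ i → let n , q , s , e = stage i ; n′ , u , _ = reached s n e in
                   n′ , subst (U i) (sym (out n′)) u)
          where
          reached : ∀ {i q} (s : Reach i q) n → run n ≡ (q , i , s) →
                    ∃ λ n′ → U i (proj₁ (proj₁ (run n′))) ×
                    ∃ λ q′ → ∃ λ s′ → run n′ ≡ (q′ , suc i , s′)
          reached (reach Q l cont) n e
            with after-step (subst (λ c → Step c (run (suc n))) e (steps n))
          ... | inj₁ (u , s′ , e′)         = suc n , u , _ , s′ , e′
          ... | inj₂ (A , lA , ¬good , e′) = reached (cont A lA ¬good) (suc n) e′

          stage : ∀ i → ∃ λ n → ∃ λ q → ∃ λ s → run n ≡ (q , i , s)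
          stage zero    = 0 , p , reach₀ , run0
          stage (suc i) = let n , _ , s , e = stage i ; n′ , _ , rest = reached s n e in n′ , rest

      determined :
        (∀ B k → InAR k (proj₁ p) → Y B → ∀ i m → ∃ λ n → m ≤ n × U i (r B (k + n))) →
        (∀ B k → InAR k (proj₁ p) → (∀ i → ∃ λ n → U i (r B (k + n))) → Y B) →
        WinI (λ B → ¬ Y B) p ⊎ WinII Y p
      determined Y⇒ ⇒Y with lem (Trapped 0 p)
      ... | yes w = inj₁ (Trapped⇒WinI w Y⇒)
      ... | no ¬w = inj₂ (Reach⇒WinII (¬Trapped⇒Reach ¬w) ⇒Y)

-- Finite bit strings as initial segments.

restrict-cong : ∀ {n u v} → Agree n u v → restrict u n ≡ restrict v n
restrict-cong e = tabulate-cong (λ i → e (toℕ i) (toℕ<n i))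

restrict-injective : ∀ n u v → restrict u n ≡ restrict v n → Agree n u v
restrict-injective n u v eq i i<n = begin
  u i                                ≡⟨ cong u (toℕ-fromℕ< i<n) ⟨
  u (toℕ (fromℕ< i<n))               ≡⟨ lookup∘tabulate (u ∘ toℕ) (fromℕ< i<n) ⟨
  lookup (restrict u n) (fromℕ< i<n) ≡⟨ cong (λ p → lookup p (fromℕ< i<n)) eq ⟩
  lookup (restrict v n) (fromℕ< i<n) ≡⟨ lookup∘tabulate (v ∘ toℕ) (fromℕ< i<n) ⟩
  v (toℕ (fromℕ< i<n))               ≡⟨ cong v (toℕ-fromℕ< i<n) ⟩
  v i                                ∎
  where open ≡-Reasoning

-- Strings of different lengths become comparable through `Agree`, without transport along equations
-- between lengths.
pad : ∀ {n} → Vec Bool n → ℕ → Bool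
pad []      _       = false
pad (b ∷ p) zero    = b
pad (b ∷ p) (suc i) = pad p i

restrict-pad : ∀ {n} (p : Vec Bool n) → restrict (pad p) n ≡ p
restrict-pad []      = refl
restrict-pad (b ∷ p) = cong (b ∷_) (restrict-pad p)

pad-restrict : ∀ n u → Agree n u (pad (restrict u n))
pad-restrict n u = restrict-injective n u _ (sym (restrict-pad (restrict u n)))

-- Kastanas games on R × 2^ω

module Projection (lem : (P : Set) → Dec P) (D : WA2Data) (isWA2 : IsWA2 D) where
  open WA2Data D
  open Notions D
  open IsWA2 isWA2 renaming (≤-refl to ≤R-refl; ≤-trans to ≤R-trans)

  D₂ : WA2Data
  D₂ = prodData D

  module D₂ = WA2Data D₂
  module N₂ = Notions D₂
  open Game lem D
  module G₂ = Game lem D₂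

  r-length : ∀ {A B m n a} → r A m ≡ a → r B n ≡ a → m ≡ n
  r-length {A} {B} {m} {n} eA eB = proj₁ (A1-3 A B m n (trans eA (sym eB)))

  r-mono : ∀ {A B m n} → m ≤ n → r A n ≡ r B n → r A m ≡ r B m
  r-mono {A} {B} {m} {n} m≤n e with m≤n⇒m<n∨m≡n m≤n
  ... | inj₁ m<n  = proj₂ (A1-3 A B n n e) m m<n
  ... | inj₂ refl = e

  ≤fin-shrink : ∀ {a A B} → A ≤R B → (∃ λ n → a ≤fin r A n) → ∃ λ n → a ≤fin r B n
  ≤fin-shrink {a} {A} {B} A≤B (n , a≤) with proj₁ (wA2-2 A B) A≤B n
  ... | m , le = m , ≤fin-trans _ _ _ a≤ le

  r₂≡ : ∀ {C u m l a} {p : Vec Bool l} → m ≡ l → r C m ≡ a → Agree l u (pad p) →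
        D₂.r (C , u) m ≡ (l , a , p)
  r₂≡ {p = p} refl refl e = cong (λ q → _ , _ , q) (trans (restrict-cong e) (restrict-pad p))

  r₂≡⁻¹ : ∀ {C} u {m l a} {p : Vec Bool l} → D₂.r (C , u) m ≡ (l , a , p) →
          m ≡ l × r C m ≡ a × Agree l u (pad p)
  r₂≡⁻¹ u {m} refl = refl , refl , pad-restrict m u

  InAR₂ : ∀ {l a} {p : Vec Bool l} → InAR l a → N₂.InAR l (l , a , p)
  InAR₂ {p = p} (A , e) = (A , pad p) , r₂≡ refl e (λ _ _ → refl)

  InAR₂⁻¹ : ∀ {m l a} {p : Vec Bool l} → N₂.InAR m (l , a , p) → InAR m a
  InAR₂⁻¹ ((A , u) , e) = A , proj₁ (proj₂ (r₂≡⁻¹ u e))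

  InAR₂-length : ∀ {m l a} {p : Vec Bool l} → N₂.InAR m (l , a , p) → m ≡ l
  InAR₂-length ((A , u) , e) = proj₁ (r₂≡⁻¹ u e)

  -- The order of the product ignores bits. Hence the bits `u` of the larger element are arbitrary,
  -- and those of the smaller one only have to begin with `p`.
  Cube₂ : ∀ {l a A B} u {v} {p : Vec Bool l} → InAR l a → Cube a A B → Agree l v (pad p) →
          N₂.Cube (l , a , p) (A , u) (B , v)
  Cube₂ {l} _ (_ , ea) (B≤A , n , eB) e =
    proj₁ (wA2-2 _ _) B≤A , l , r₂≡ refl (subst (λ m → r _ m ≡ _) (r-length eB ea) eB) e

  Cube₂⁻¹ : ∀ {l a A B} u v {p : Vec Bool l} → N₂.Cube (l , a , p) (A , u) (B , v) →
            Cube a A B × Agree l v (pad p)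
  Cube₂⁻¹ _ v (le , n , e) = (proj₂ (wA2-2 _ _) le , n , proj₁ (proj₂ (r₂≡⁻¹ v e))) , proj₂ (proj₂ (r₂≡⁻¹ v e))

  NextApprox-length : ∀ {a A b l} → NextApprox a A b → InAR l a → InAR (suc l) b
  NextApprox-length {b = b} (_ , _ , j , (_ , ea) , ib) (_ , ea′) =
    subst (λ m → InAR (suc m) b) (r-length ea ea′) ib

  NextApprox₂ : ∀ {a A b l} u {p : Vec Bool l} {q : Vec Bool (suc l)} → NextApprox a A b →
                InAR l a → Agree l (pad q) (pad p) → N₂.NextApprox (l , a , p) (A , u) (suc l , b , q)
  NextApprox₂ {l = l} _ {q = q} next@((_ , le) , (E , m , n , m≤n , eₘ , eₙ) , _) ia@(_ , ea) e =
    let ib@(_ , eb) = NextApprox-length next ia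
        m≡l = r-length eₘ ea ; n≡l′ = r-length eₙ eb in
    ((suc l , InAR₂ ib) , le) ,
    ((E , pad q) , m , n , m≤n , r₂≡ m≡l eₘ e , r₂≡ n≡l′ eₙ (λ _ _ → refl)) ,
    l , InAR₂ ia , InAR₂ ib

  NextApprox₂⁻¹ : ∀ {a A b l l′} u {p : Vec Bool l} {q : Vec Bool l′} →
                  N₂.NextApprox (l , a , p) (A , u) (l′ , b , q) →
                  NextApprox a A b × l′ ≡ suc l × Agree l (pad q) (pad p)
  NextApprox₂⁻¹ _ (((n , ib) , le) , ((E , w) , m , n′ , m≤n′ , eₘ , eₙ) , j , ia , ib′) =
    let m≡l , ea , ew = r₂≡⁻¹ w eₘ ; n′≡l′ , eb , ew′ = r₂≡⁻¹ w eₙ in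
    (((n , InAR₂⁻¹ ib) , le) , (E , m , n′ , m≤n′ , ea , eb) , j , InAR₂⁻¹ ia , InAR₂⁻¹ ib′) ,
    trans (sym (InAR₂-length ib′)) (cong suc (InAR₂-length ia)) ,
    λ i i<l → trans
      (sym (ew′ i (≤-trans i<l (subst₂ _≤_ m≡l n′≡l′ m≤n′)))) (ew i i<l)

  -- Row `n` has settled the bits below `k + n`, so row `suc i` has settled bit `i` whatever `k` is;
  -- the limit is this diagonal.
  coherent-limit : {w : ℕ → ℕ → Bool} {k : ℕ} → (∀ n → Agree (k + n) (w (suc n)) (w n)) →
            ∃ λ u → ∀ n → Agree (k + n) u (w n)
  coherent-limit {w} {k} coherent = (λ i → w (suc i) i) , λ n i i<k+n →
    [ (λ n≤1+i → later n≤1+i i i<k+n)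
    , (λ 1+i≤n → sym (later 1+i≤n i (m≤n+m (suc i) k))) ]′ (≤-total n (suc i))
    where
    later+ : ∀ d m → Agree (k + m) (w (m + d)) (w m)
    later+ zero    m i _ = cong (λ n → w n i) (+-identityʳ m)
    later+ (suc d) m i i< = trans (cong (λ n → w n i) (+-suc m d))
      (trans (coherent (m + d) i (≤-trans i< (+-monoʳ-≤ k (m≤m+n m d)))) (later+ d m i i<))
    later : ∀ {m n} → m ≤ n → Agree (k + m) (w n) (w m)
    later {m} m≤n with m≤n⇒∃[o]m+o≡n m≤n
    ... | d , refl = later+ d m

  -- Transfer of winning strategies from the product to R.

  module _ {X : R → Set} {Y : R × (ℕ → Bool) → Set} {k : ℕ} {a : AR} {p₀ : Vec Bool k}
           {B₀ : R} {v₀ : ℕ → Bool} (ia₀ : InAR k a) where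

    -- A move `A` of I is handed to the product strategy as `(A , pad p)`, which is legal since it
    -- begins with the current string `p`. The strings chosen in reply extend one another; their
    -- limit `u` puts `(B , u)` into `Y`.
    project-II : (∀ C u → Y (C , u) → X C) →
                 G₂.WinII Y ((k , a , p₀) , (B₀ , v₀)) → WinII X (a , B₀)
    project-II Y⇒X W = record
      { machine = machine ; start = k , p₀ , v₀ , ia₀ , W.start ; wins = wins }
      where
      module W = G₂.WinII W

      answer : ∀ {b B l p v} → InAR l b → (s : W.State ((l , b , p) , (B , v))) → ∀ A →
               MoveI (b , B) A →
               Σ G₂.Pos λ q → G₂.MoveII ((l , b , p) , (B , v)) (A , pad p) q × W.State q
      answer {p = p} {v} ib s A lA = W.respond s (A , pad p) (Cube₂ v ib lA (λ _ _ → refl))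

      machine : MachineII
      machine = record
        { State = λ (b , B) → Σ ℕ λ l → Σ (Vec Bool l) λ p → Σ (ℕ → Bool) λ v →
                    InAR l b × W.State ((l , b , p) , (B , v))
        ; respond = λ { (l , p , v , ib , s) A lA →
            let ((l′ , b′ , p′) , (B′ , v′)) , (next , cube) , s′ = answer ib s A lA
                next′ , l′≡ , _ = NextApprox₂⁻¹ (pad p) next in
            (b′ , B′) , (next′ , proj₁ (Cube₂⁻¹ (pad p) v′ cube)) ,
            l′ , p′ , v′ , subst (λ l → InAR l b′) (sym l′≡) (NextApprox-length next′ ib) , s′ } }
      open MachineII machine using (Config; Step; step)

      lift : Config → W.Config
      lift ((b , B) , l , p , v , ib , s) = ((l , b , p) , (B , v)) , s

      len : Config → ℕ
      len (_ , l , _) = l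

      bits : Config → ℕ → Bool
      bits (_ , _ , p , _) = pad p

      lift-step : ∀ {c c′} → Step c c′ →
                  W.Step (lift c) (lift c′) × len c′ ≡ suc (len c) × Agree (len c) (bits c′) (bits c)
      lift-step (step {s = l , p , v , ib , s} A lA) =
        W.step (A , pad p) (Cube₂ v ib lA (λ _ _ → refl)) ,
        proj₂ (NextApprox₂⁻¹ (pad p) (proj₁ (proj₁ (proj₂ (answer ib s A lA)))))

      wins : ∀ run → run 0 ≡ ((a , B₀) , k , p₀ , v₀ , ia₀ , W.start) →
             (∀ n → Step (run n) (run (suc n))) → ∀ B → Outcome (proj₁ ∘ run) B → X B
      wins run run0 steps B (k′ , (_ , ek′) , out) =
        Y⇒X B u (W.wins (lift ∘ run) (cong lift run0) (λ n → proj₁ (lift-step (steps n))) (B , u)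
          (k , subst (N₂.InAR k ∘ proj₁ ∘ proj₁ ∘ lift) (sym run0) (InAR₂ ia₀) ,
           λ n → r₂≡ (sym (len≡ n)) (subst (λ m → r B (m + n) ≡ _) k′≡k (out n))
                     (subst (λ m → Agree m u (bits (run n))) (sym (len≡ n)) (proj₂ limit n))))
        where
        k′≡k : k′ ≡ k
        k′≡k = r-length ek′ (trans (proj₂ ia₀) (cong (proj₁ ∘ proj₁) (sym run0)))

        len≡ : ∀ n → len (run n) ≡ k + n
        len≡ zero    = trans (cong len run0) (sym (+-identityʳ k))
        len≡ (suc n) = trans (proj₁ (proj₂ (lift-step (steps n))))
                             (trans (cong suc (len≡ n)) (sym (+-suc k n)))

        limit : ∃ λ u → ∀ n → Agree (k + n) u (bits (run n))
        limit = coherent-limit (λ n → subst (λ m → Agree m (bits (run (suc n))) (bits (run n)))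
                                     (len≡ n) (proj₂ (proj₂ (lift-step (steps n)))))

        u : ℕ → Bool
        u = proj₁ limit

    -- I follows one thread of the game on R × 2^ω for each bit string, all threads
    -- with the same approximations. I's current element passes through the finitely
    -- many threads one after the other, so that the last answer lies below all of them.
    project-I : (∀ C → X C → ∃ λ u → Agree k u (pad p₀) × Y (C , u)) →
                G₂.WinI (λ x → ¬ Y x) ((k , a , p₀) , (B₀ , v₀)) → WinI (λ C → ¬ X C) (a , B₀)
    project-I X⇒Y W = record
      { machine = machine
      ; start = proj₁ (W.move W.start) , proj₁ (Cube₂⁻¹ v₀ (proj₂ (W.move W.start)) (W.move-legal W.start)) ,
                (pad p₀ , c₀) ∷ [] ,
                (k , cong (λ p → k , a , p) (sym (restrict-pad p₀)) , ia₀ , ≤R-refl _) ∷ []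
      ; wins = wins }
      where
      module W = G₂.WinI W

      c₀ : W.Config
      c₀ = ((k , a , p₀) , (B₀ , v₀)) , W.start

      Thread : Set
      Thread = (ℕ → Bool) × W.Config

      len : Thread → ℕ
      len (_ , ((l , _) , _) , _) = l

      planned : Thread → R
      planned (_ , _ , s) = proj₁ (W.move s)

      -- The bound `C ≤R planned e` makes the approximation with which II answers `C` legal also
      -- against the pending move of the thread. Lowering `C` preserves it, so one `C` can serve all
      -- threads.
      Valid : AR → R → Thread → Set
      Valid b C e@(u , (q , _) , _) =
        ∃ λ l → q ≡ (l , b , restrict u l) × InAR l b × C ≤R planned e

      Child : Bool → Thread → Thread → Set
      Child bit e e′ = W.Step (proj₂ e) (proj₂ e′) × Agree (len e) (proj₁ e′) (proj₁ e) ×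
                       proj₁ e′ (len e) ≡ bit × len e′ ≡ suc (len e)

      Has : AR → R → Set
      Has b C = ∃ λ n → r C n ≡ b

      child : ∀ {b b′ C C₀ e} bit → NextApprox b C b′ → Valid b C e → C₀ ≤R C → Has b′ C₀ →
              ∃ λ e′ → Child bit e e′ × planned e′ ≤R C₀ × Has b′ (planned e′) ×
                       Valid b′ (planned e′) e′
      child {b} {b′} {C} {C₀} {u , (_ , (B , v)) , s} bit next (l , refl , ib , C≤) C₀≤ has =
        e′ ,
        (W.step q legal , update-below u l bit , update-at u l bit , refl) ,
        proj₁ cube , proj₂ cube , suc l , refl , ib′ , ≤R-refl _
        where
        u′ : ℕ → Bool
        u′ = update u l bit
        ib′ : InAR (suc l) b′
        ib′ = NextApprox-length next ib
        q : G₂.Pos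
        q = (suc l , b′ , restrict u′ (suc l)) , (C₀ , u′)
        pad-u′ : Agree (suc l) u′ (pad (restrict u′ (suc l)))
        pad-u′ = pad-restrict (suc l) u′
        pad-u : Agree l u (pad (restrict u l))
        pad-u = pad-restrict l u
        next′ : NextApprox b (proj₁ (W.move s)) b′
        next′ = let (ib , le) , rest = next in (ib , ≤fin-shrink C≤ le) , rest
        legal : G₂.MoveII ((l , b , restrict u l) , (B , v)) (W.move s) q
        legal = NextApprox₂ (proj₂ (W.move s)) next′ ib (λ i i<l →
                  trans (sym (pad-u′ i (<⇒≤ (s≤s i<l))))
                    (trans (update-below u l bit i i<l) (pad-u i i<l))) ,
                Cube₂ (proj₂ (W.move s)) ib′ (≤R-trans _ _ _ C₀≤ C≤ , has) pad-u′
        e′ : Thread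
        e′ = u′ , q , W.next s q legal
        cube : Cube b′ C₀ (planned e′)
        cube = proj₁ (Cube₂⁻¹ u′ (proj₂ (W.move (W.next s q legal))) (W.move-legal (W.next s q legal)))

      Children : List Thread → List Thread → Set
      Children es es′ = ∀ {e} → e ∈ es → ∀ bit → ∃ λ e′ → e′ ∈ es′ × Child bit e e′

      Valid-shrink : ∀ {b C C′} e → C′ ≤R C → Valid b C e → Valid b C′ e
      Valid-shrink _ le (l , eq , ib , C≤) = l , eq , ib , ≤R-trans _ _ _ le C≤

      branch : ∀ {b b′ C C₀} → NextApprox b C b′ → ∀ es → All (Valid b C) es → C₀ ≤R C →
               Has b′ C₀ → ∃ λ C₁ → (C₁ ≤R C₀ × Has b′ C₁) ×
               ∃ λ es′ → All (Valid b′ C₁) es′ × Children es es′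
      branch {C₀ = C₀} next [] [] C₀≤ has = C₀ , (≤R-refl _ , has) , [] , [] , λ ()
      branch next (e ∷ es) (valid ∷ valids) C₀≤ has =
        let e₁ , child₁ , le₁ , has₁ , valid₁ = child false next valid C₀≤ has
            e₂ , child₂ , le₂ , has₂ , valid₂ =
              -- The thread with bit `true` starts from the element just planned for bit `false`, so
              -- its planned element lies below both.
              child true next valid (≤R-trans _ _ _ le₁ C₀≤) has₁
            C₃ , (le₃ , has₃) , es′ , valids′ , children =
              branch next es valids (≤R-trans _ _ _ le₂ (≤R-trans _ _ _ le₁ C₀≤)) has₂
        in C₃ , (≤R-trans _ _ _ le₃ (≤R-trans _ _ _ le₂ le₁) , has₃) , e₁ ∷ e₂ ∷ es′ ,
           Valid-shrink e₁ (≤R-trans _ _ _ le₃ le₂) valid₁ ∷ Valid-shrink e₂ le₃ valid₂ ∷ valids′ ,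
           λ { (here refl) false → e₁ , here refl , child₁
             ; (here refl) true  → e₂ , there (here refl) , child₂
             ; (there e∈) bit → let e′ , e′∈ , c = children e∈ bit in
                                e′ , there (there e′∈) , c }

      machine : MachineI
      machine = record
        { State = λ (b , B) → ∃ λ C → Cube b B C × ∃ λ es → All (Valid b C) es
        ; move = proj₁
        ; move-legal = λ (_ , cube , _) → cube
        ; next = λ { (C , _ , es , valids) (b′ , B′) (next , (B′≤C , has)) →
            let C₁ , cube , es′ , valids′ , _ = branch next es valids B′≤C has in
            C₁ , cube , es′ , valids′ } }
      open MachineI machine using (Config; Step; step)

      threads : Config → List Thread
      threads (_ , _ , _ , es , _) = es

      Step-children : ∀ {c c′} → Step c c′ → Children (threads c) (threads c′)
      Step-children (step {s = C , _ , es , valids} (b′ , B′) (next , (B′≤C , has))) =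
        proj₂ (proj₂ (proj₂ (proj₂ (branch next es valids B′≤C has))))

      valid-all : ∀ c → All (Valid (proj₁ (proj₁ c)) (proj₁ (proj₂ c))) (threads c)
      valid-all (_ , _ , _ , _ , valids) = valids

      wins : ∀ run → run 0 ≡ _ → (∀ n → Step (run n) (run (suc n))) →
             ∀ B → Outcome (proj₁ ∘ run) B → ¬ X B
      wins run run0 steps B (k′ , (_ , ek′) , out) x =
        W.wins (proj₂ ∘ thread) refl (λ n → proj₁ (thread-child n)) (B , u)
          (k , InAR₂ ia₀ , outcome) y
        where
        u : ℕ → Bool
        u = proj₁ (X⇒Y B x)
        u-pad : Agree k u (pad p₀)
        u-pad = proj₁ (proj₂ (X⇒Y B x))
        y : Y (B , u)
        y = proj₂ (proj₂ (X⇒Y B x))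

        k′≡k : k′ ≡ k
        k′≡k = r-length ek′ (trans (proj₂ ia₀) (cong (proj₁ ∘ proj₁) (sym run0)))

        -- The bits of `u` select one child per round. The thread followed in this way is a run of
        -- the product strategy with outcome `(B , u)`, contradicting `y`.
        path : ∀ n → ∃ λ e → e ∈ threads (run n)
        path zero    = (pad p₀ , c₀) , subst ((pad p₀ , c₀) ∈_) (sym (cong threads run0)) (here refl)
        path (suc n) = let e , e∈ = path n ; e′ , e′∈ , _ = Step-children (steps n) e∈ (u (k + n)) in
                       e′ , e′∈

        thread : ℕ → Thread
        thread n = proj₁ (path n)

        thread-child : ∀ n → Child (u (k + n)) (thread n) (thread (suc n))
        thread-child n = proj₂ (proj₂ (Step-children (steps n) (proj₂ (path n)) (u (k + n))))

        len≡ : ∀ n → len (thread n) ≡ k + n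
        len≡ zero    = sym (+-identityʳ k)
        len≡ (suc n) = trans (proj₂ (proj₂ (proj₂ (thread-child n))))
                             (trans (cong suc (len≡ n)) (sym (+-suc k n)))

        agree : ∀ n → Agree (k + n) u (proj₁ (thread n))
        agree zero    i i< = u-pad i (subst (i <_) (+-identityʳ k) i<)
        agree (suc n) i i< with thread-child n
        ... | _ , below , new , _ with <-suc-cases (subst (i <_) (+-suc k n) i<)
        ...   | inj₁ i<k+n = trans (agree n i i<k+n)
                               (sym (below i (subst (i <_) (sym (len≡ n)) i<k+n)))
        ...   | inj₂ refl  = sym (trans (cong (proj₁ (thread (suc n))) (sym (len≡ n))) new)

        outcome : ∀ n → D₂.r (B , u) (k + n) ≡ proj₁ (proj₁ (proj₂ (thread n)))
        outcome n with All.lookup (valid-all (run n)) (proj₂ (path n)) | len≡ n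
        ... | l , eq , _ | len-n =
          trans (r₂≡ k+n≡l (subst (λ m → r B (m + n) ≡ _) k′≡k (out n))
                  (λ i i<l → trans (agree n i (subst (i <_) (sym k+n≡l) i<l))
                    (pad-restrict l (proj₁ (thread n)) i i<l)))
                (sym eq)
          where
          k+n≡l : k + n ≡ l
          k+n≡l = trans (sym len-n) (cong proj₁ eq)

-- The projective hierarchy

record UltrametricSpace (S : Space) : Set where
  open Space S
  field
    nbhd-refl  : ∀ {n p} → Nbhd n p p
    nbhd-sym   : ∀ {n p q} → Nbhd n p q → Nbhd n q p
    nbhd-trans : ∀ {n p q s} → Nbhd n p q → Nbhd n q s → Nbhd n p s
    nbhd-mono  : ∀ {m n p q} → m ≤ n → Nbhd n p q → Nbhd m p q

×Baire-ultrametric : ∀ {S} → UltrametricSpace S → UltrametricSpace (S ×Baire)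
×Baire-ultrametric S-um = record
  { nbhd-refl  = nbhd-refl , λ _ _ → refl
  ; nbhd-sym   = λ (e , a) → nbhd-sym e , Agree-sym a
  ; nbhd-trans = λ (e , a) (e′ , a′) → nbhd-trans e e′ , λ i i<n → trans (a i i<n) (a′ i i<n)
  ; nbhd-mono  = λ m≤n (e , a) → nbhd-mono m≤n e , Agree-≤ m≤n a }
  where open UltrametricSpace S-um

Continuous : (S T : Space) → (Space.Pt S → Space.Pt T) → Set
Continuous S T f = ∀ p n → ∃ λ m → ∀ q → Space.Nbhd S m p q → Space.Nbhd T n (f p) (f q)

module Topology (lem : (P : Set) → Dec P) where

  by-contradiction : {P : Set} → ¬ ¬ P → P
  by-contradiction {P} = decidable-stable (lem P)

  ¬∀⇒∃¬ : {I : Set} {P : I → Set} → ¬ (∀ i → P i) → ∃ λ i → ¬ P i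
  ¬∀⇒∃¬ ¬all = by-contradiction λ none → ¬all λ i → by-contradiction λ ¬p → none (i , ¬p)

  Closed-preimage : ∀ {S T f C} → Continuous S T f → Closed T C → Closed S (C ∘ f)
  Closed-preimage {f = f} cont closed p ¬c =
    let n , out = closed (f p) ¬c ; m , near = cont p n in m , λ q pq → out (f q) (near q pq)

  Closed-∩ : ∀ {S C C′} → Closed S C → Closed S C′ → Closed S (λ p → C p × C′ p)
  Closed-∩ {C = C} {C′} cl cl′ p ¬cc′ with lem (C p)
  ... | no ¬c = let n , out = cl p ¬c in n , λ q pq (c , _) → out q pq c
  ... | yes c = let n , out = cl′ p (λ c′ → ¬cc′ (c , c′)) in n , λ q pq (_ , c′) → out q pq c′

  module _ {S : Space} (S-um : UltrametricSpace S) where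
    open Space S
    open UltrametricSpace S-um

    Closed-∪ : ∀ {C C′} → Closed S C → Closed S C′ → Closed S (λ p → C p ⊎ C′ p)
    Closed-∪ cl cl′ p ¬cc′ =
      let m , out = cl p (¬cc′ ∘ inj₁) ; n , out′ = cl′ p (¬cc′ ∘ inj₂) in
      m ⊔ n , λ q pq → [ out q (nbhd-mono (m≤m⊔n m n) pq) , out′ q (nbhd-mono (m≤n⊔m m n) pq) ]′

    -- `w 0` is constant near a given point, so only one of the sets `C i` is relevant there.
    -- Projecting along `w` then yields countable unions.
    Closed-fibres : ∀ {C : ℕ → Space.Pt (S ×Baire) → Set} → (∀ i → Closed (S ×Baire) (C i)) →
                    Closed (S ×Baire) (λ (x , w) → C (w 0) (x , w ∘ suc))
    Closed-fibres {C} cl (x , w) ¬c =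
      let n , out = cl (w 0) (x , w ∘ suc) ¬c in
      suc n , λ (x′ , w′) (xx′ , ww′) c → out (x′ , w′ ∘ suc)
        (nbhd-mono (n≤1+n n) xx′ , λ i i<n → ww′ (suc i) (s≤s i<n))
        (subst (λ i → C i (x′ , w′ ∘ suc)) (sym (ww′ 0 (s≤s z≤n))) c)

  Fσ : (S : Space) → (Space.Pt S → Set) → Set₁
  Fσ S F = ∃ λ (C : ℕ → Space.Pt S → Set) → (∀ i → Closed S (C i)) ×
           (∀ x → (F x → ∃ λ i → C i x) × ((∃ λ i → C i x) → F x))

  -- A class that contains the closed sets and is stable under complement: the inductions below pass
  -- between `Sigma` and `Pi` by complementing, which exchanges unions and intersections.
  Δ⁰₂ : (S : Space) → (Space.Pt S → Set) → Set₁
  Δ⁰₂ S F = Fσ S F × Fσ S (λ x → ¬ F x)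

  Fσ-preimage : ∀ {S T f F} → Continuous S T f → Fσ T F → Fσ S (F ∘ f)
  Fσ-preimage {f = f} cont (C , cl , iff) =
    (λ i → C i ∘ f) , (λ i → Closed-preimage cont (cl i)) , λ x → iff (f x)

  Δ⁰₂-preimage : ∀ {S T f F} → Continuous S T f → Δ⁰₂ T F → Δ⁰₂ S (F ∘ f)
  Δ⁰₂-preimage cont (σ , π) = Fσ-preimage cont σ , Fσ-preimage cont π

  Δ⁰₂-¬ : ∀ {S F} → Δ⁰₂ S F → Δ⁰₂ S (λ x → ¬ F x)
  Δ⁰₂-¬ ((C , cl , iff) , π) = π , C , cl , λ x →
    (λ ¬¬f → proj₁ (iff x) (by-contradiction ¬¬f)) , (λ c ¬f → ¬f (proj₂ (iff x) c))

  -- The complement is the union over `n` of the sets of points whose level-`n` neighbourhood misses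
  -- `F`. These sets are closed because all points of such a neighbourhood share it.
  Closed⇒Δ⁰₂ : ∀ {S F} → UltrametricSpace S → Closed S F → Δ⁰₂ S F
  Closed⇒Δ⁰₂ {S} {F} S-um cl =
    ((λ _ → F) , (λ _ → cl) , λ x → (λ f → 0 , f) , proj₂) ,
    (λ n x → ∀ q → Nbhd n x q → ¬ F q) , inner-closed ,
    λ x → cl x , λ (n , out) f → out x nbhd-refl f
    where
    open Space S
    open UltrametricSpace S-um
    inner-closed : ∀ n → Closed S (λ x → ∀ q → Nbhd n x q → ¬ F q)
    inner-closed n x ¬out = n , λ x′ xx′ out →
      ¬out λ q xq → out q (nbhd-trans (nbhd-sym xx′) xq)

  proj₁-continuous : ∀ {S} → Continuous (S ×Baire) S proj₁
  proj₁-continuous p n = n , λ q → proj₁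

  ×Baire-continuous : ∀ {S T f} → UltrametricSpace S → Continuous S T f →
                      Continuous (S ×Baire) (T ×Baire) (λ (x , y) → f x , y)
  ×Baire-continuous S-um cont (x , y) n =
    let m , near = cont x n in
    m ⊔ n , λ (x′ , y′) (xx′ , yy′) →
      near x′ (nbhd-mono (m≤m⊔n m n) xx′) , Agree-≤ (m≤n⊔m m n) yy′
    where open UltrametricSpace S-um

  mutual
    Sigma-preimage : ∀ n {S T f P} → UltrametricSpace S → Continuous S T f →
                     Sigma n T P → Sigma n S (P ∘ f)
    Sigma-preimage zero {T = T} {f} um cont (C , c , iff) =
      (λ (x , y) → C (f x , y)) , Closed-preimage (×Baire-continuous {T = T} {f} um cont) c , λ x → iff (f x)
    Sigma-preimage (suc n) {T = T} {f} um cont (C , c , iff) =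
      (λ (x , y) → C (f x , y)) ,
      Pi-preimage n (×Baire-ultrametric um) (×Baire-continuous {T = T} {f} um cont) c , λ x → iff (f x)

    Pi-preimage : ∀ n {S T f P} → UltrametricSpace S → Continuous S T f →
                  Pi n T P → Pi n S (P ∘ f)
    Pi-preimage n {f = f} um cont (Q , q , iff) =
      Q ∘ f , Sigma-preimage n um cont q , λ x → iff (f x)

  mutual
    Sigma-∪ : ∀ n {S F P} → UltrametricSpace S → Δ⁰₂ S F → Sigma n S P →
              Sigma n S (λ x → F x ⊎ P x)
    Sigma-∪ zero {S} {F} {P} um ((E , e , iffE) , _) (C , c , iff) =
      (λ (x , w) → C′ (w 0) (x , w ∘ suc)) , Closed-fibres um closed′ , λ x →
        [ (λ f → let i , d = proj₁ (iffE x) f in (λ _ → suc i) , d)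
        , (λ p → let y , d = proj₁ (iff x) p in (λ { zero → 0 ; (suc j) → y j }) , d) ]′ ,
        λ (w , d) → back (w 0) (w ∘ suc) d
      where
      -- The entry `w 0` is a tag: `0` announces a witness for `P`, and `suc i` membership in `E i`.
      C′ : ℕ → Space.Pt (S ×Baire) → Set
      C′ zero    = C
      C′ (suc i) = E i ∘ proj₁
      closed′ : ∀ i → Closed (S ×Baire) (C′ i)
      closed′ zero    = c
      closed′ (suc i) = Closed-preimage (proj₁-continuous {S}) (e i)
      back : ∀ {x} i y → C′ i (x , y) → F x ⊎ P x
      back {x} zero    y d = inj₂ (proj₂ (iff x) (y , d))
      back {x} (suc i) y d = inj₁ (proj₂ (iffE x) (i , d))
    Sigma-∪ (suc n) {S} um δ (C , c , iff) =
      _ , Pi-∪ n (×Baire-ultrametric um) (Δ⁰₂-preimage (proj₁-continuous {S}) δ) c , λ x →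
        [ (λ f → (λ _ → 0) , inj₁ f) , (λ p → let y , d = proj₁ (iff x) p in y , inj₂ d) ]′ ,
        λ { (y , inj₁ f) → inj₁ f ; (y , inj₂ d) → inj₂ (proj₂ (iff x) (y , d)) }

    Sigma-∩ : ∀ n {S F P} → UltrametricSpace S → Δ⁰₂ S F → Sigma n S P →
              Sigma n S (λ x → F x × P x)
    Sigma-∩ zero {S} um ((E , e , iffE) , _) (C , c , iff) =
      (λ (x , w) → E (w 0) x × C (x , w ∘ suc)) ,
      Closed-fibres um {λ i (x , y) → E i x × C (x , y)}
        (λ i → Closed-∩ {S ×Baire} (Closed-preimage (proj₁-continuous {S}) (e i)) c) , λ x →
        (λ (f , p) → let i , d = proj₁ (iffE x) f ; y , d′ = proj₁ (iff x) p in
                     (λ { zero → i ; (suc j) → y j }) , d , d′) ,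
        λ (w , d , d′) → proj₂ (iffE x) (w 0 , d) , proj₂ (iff x) (w ∘ suc , d′)
    Sigma-∩ (suc n) {S} um δ (C , c , iff) =
      _ , Pi-∩ n (×Baire-ultrametric um) (Δ⁰₂-preimage (proj₁-continuous {S}) δ) c , λ x →
        (λ (f , p) → let y , d = proj₁ (iff x) p in y , f , d) ,
        λ (y , f , d) → f , proj₂ (iff x) (y , d)

    Pi-∪ : ∀ n {S F P} → UltrametricSpace S → Δ⁰₂ S F → Pi n S P → Pi n S (λ x → F x ⊎ P x)
    Pi-∪ n {F = F} um δ (Q , q , iff) = _ , Sigma-∩ n um (Δ⁰₂-¬ δ) q , λ x →
      [ (λ f (¬f , _) → ¬f f) , (λ p (_ , q) → proj₁ (iff x) p q) ]′ ,
      λ ¬fq → case x ¬fq (lem (F x))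
      where
      case : ∀ x → ¬ (¬ F x × Q x) → Dec (F x) → _
      case x ¬fq (yes f) = inj₁ f
      case x ¬fq (no ¬f) = inj₂ (proj₂ (iff x) λ q → ¬fq (¬f , q))

    Pi-∩ : ∀ n {S F P} → UltrametricSpace S → Δ⁰₂ S F → Pi n S P → Pi n S (λ x → F x × P x)
    Pi-∩ n um δ (Q , q , iff) = _ , Sigma-∪ n um (Δ⁰₂-¬ δ) q , λ x →
      (λ (f , p) → [ (λ ¬f → ¬f f) , proj₁ (iff x) p ]′) ,
      λ ¬fq → by-contradiction (¬fq ∘ inj₁) , proj₂ (iff x) (¬fq ∘ inj₂)

  -- Sigma n S P says that P x ⇔ ∃ y, C (x , y) for some C with Matrix n (S ×Baire) C.
  data Matrix : ℕ → (S : Space) → (Space.Pt S → Set) → Set₁ where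
    closed : ∀ {S C} → Closed S C → Matrix zero S C
    pi     : ∀ {n S C} → Pi n S C → Matrix (suc n) S C

  Projection-of : (S : Space) → (Space.Pt S → Set) → (Space.Pt (S ×Baire) → Set) → Set
  Projection-of S P C = ∀ x → (P x → ∃ λ y → C (x , y)) × ((∃ λ y → C (x , y)) → P x)

  Sigma⇒Matrix : ∀ n {S P} → Sigma n S P →
                 ∃ λ C → Matrix n (S ×Baire) C × Projection-of S P C
  Sigma⇒Matrix zero    (C , c , iff) = C , closed c , iff
  Sigma⇒Matrix (suc n) (C , c , iff) = C , pi c , iff

  Matrix⇒Sigma : ∀ {n S P C} → Matrix n (S ×Baire) C → Projection-of S P C → Sigma n S P
  Matrix⇒Sigma (closed c) iff = _ , c , iff
  Matrix⇒Sigma (pi c)     iff = _ , c , iff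

  -- The shape is that of the complement of the coded set: either a row is empty, or a coded
  -- sequence lies outside the given set.
  Matrix-combine : ∀ {n S T f F G C} → UltrametricSpace S → Continuous S T f →
                   Closed S F → Closed S G → Matrix n T C →
                   Matrix n S (λ x → F x ⊎ (G x × C (f x)))
  Matrix-combine {S = S} um cont F-closed G-closed (closed c) =
    closed (Closed-∪ um F-closed (Closed-∩ {S} G-closed (Closed-preimage cont c)))
  Matrix-combine {suc n} um cont F-closed G-closed (pi c) =
    pi (Pi-∪ n um (Closed⇒Δ⁰₂ um F-closed)
      (Pi-∩ n um (Closed⇒Δ⁰₂ um G-closed) (Pi-preimage n um cont c)))

  -- Replaces function extensionality on the Baire coordinates.
  Inseparable : (S : Space) → Space.Pt S → Space.Pt S → Set
  Inseparable S p q = ∀ n → Space.Nbhd S n p q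

  Closed-ext : ∀ {S C} → UltrametricSpace S → Closed S C → ∀ {p q} → Inseparable S p q → C p → C q
  Closed-ext um cl pq c = by-contradiction λ ¬c →
    let n , out = cl _ ¬c in out _ (nbhd-sym (pq n)) c
    where open UltrametricSpace um

  mutual
    Sigma-ext : ∀ n {S P} → UltrametricSpace S → Sigma n S P →
                ∀ {p q} → Inseparable S p q → P p → P q
    Sigma-ext n um sig pq p with Sigma⇒Matrix n sig
    ... | C , c , iff = let y , d = proj₁ (iff _) p in
      proj₂ (iff _) (y , Matrix-ext (×Baire-ultrametric um) c (λ n → pq n , λ _ _ → refl) d)

    Pi-ext : ∀ n {S P} → UltrametricSpace S → Pi n S P →
             ∀ {p q} → Inseparable S p q → P p → P q
    Pi-ext n um (Q , q , iff) pq p = proj₂ (iff _) λ q′ →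
      proj₁ (iff _) p (Sigma-ext n um q (λ n → nbhd-sym (pq n)) q′)
      where open UltrametricSpace um

    Matrix-ext : ∀ {n S C} → UltrametricSpace S → Matrix n S C →
                 ∀ {p q} → Inseparable S p q → C p → C q
    Matrix-ext um (closed c)     = Closed-ext um c
    Matrix-ext {suc n} um (pi c) = Pi-ext n um c

-- Coding elements of Baire space by bits

-- Pairs with sum s receive codes between s² and s² + s; these blocks are disjoint because s² + s <
-- (s + 1)². Injectivity is all that the coding asks for.
square-pair : ℕ → ℕ → ℕ
square-pair i j = (i + j) * (i + j) + i

square-pair-< : ∀ i j i′ j′ → i + j < i′ + j′ → square-pair i j < square-pair i′ j′
square-pair-< i j i′ j′ s<s′ = begin-strict
  s * s + i            ≤⟨ +-monoʳ-≤ (s * s) (m≤m+n i j) ⟩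
  s * s + s            ≡⟨ +-comm (s * s) s ⟩
  suc s * s            <⟨ *-monoʳ-< (suc s) ≤-refl ⟩
  suc s * suc s        ≤⟨ *-mono-≤ s<s′ s<s′ ⟩
  s′ * s′              ≤⟨ m≤m+n (s′ * s′) i′ ⟩
  s′ * s′ + i′         ∎
  where
  open ≤-Reasoning
  s  = i + j
  s′ = i′ + j′

square-pair-injective : ∀ i j i′ j′ → square-pair i j ≡ square-pair i′ j′ → i ≡ i′ × j ≡ j′
square-pair-injective i j i′ j′ eq with <-cmp (i + j) (i′ + j′)
... | tri< s<s′ _ _ = ⊥-elim (<⇒≢ (square-pair-< i j i′ j′ s<s′) eq)
... | tri> _ _ s′<s = ⊥-elim (<⇒≢ (square-pair-< i′ j′ i j s′<s) (sym eq))
... | tri≈ _ s≡s′ _ = i≡i′ , +-cancelˡ-≡ i j j′ (trans s≡s′ (cong (_+ j′) (sym i≡i′)))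
  where
  i≡i′ : i ≡ i′
  i≡i′ = +-cancelˡ-≡ ((i + j) * (i + j)) i i′ (trans eq (cong (λ s → s * s + i′) (sym s≡s′)))

i≤square-pair : ∀ i j → i ≤ square-pair i j
i≤square-pair i j = m≤n+m i _

interleave : (ℕ → ℕ) → (ℕ → ℕ) → ℕ → ℕ
interleave y z zero          = y 0
interleave y z (suc zero)    = z 0
interleave y z (suc (suc n)) = interleave (y ∘ suc) (z ∘ suc) n

interleave-even : ∀ y z i → interleave y z (i + i) ≡ y i
interleave-even y z zero    = refl
interleave-even y z (suc i) rewrite +-suc i i = interleave-even (y ∘ suc) (z ∘ suc) i

interleave-odd : ∀ y z i → interleave y z (suc (i + i)) ≡ z i
interleave-odd y z zero    = refl
interleave-odd y z (suc i) rewrite +-suc i i = interleave-odd (y ∘ suc) (z ∘ suc) i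

bounded : ∀ (f : ℕ → ℕ) n → ∃ λ M → ∀ i → i < n → f i < M
bounded f zero    = 0 , λ _ ()
bounded f (suc n) = let M , below = bounded f n in
  M ⊔ suc (f n) , λ i i<1+n → [ (λ i<n → ≤-trans (below i i<n) (m≤m⊔n M _))
                              , (λ { refl → m≤n⊔m M _ }) ]′ (<-suc-cases i<1+n)

module Coding (lem : (P : Set) → Dec P) (D : WA2Data) (isWA2 : IsWA2 D) (k : ℕ) where
  open WA2Data D
  open Notions D
  open Topology lem
  open Projection lem D isWA2

  S S₂ : Space
  S  = spaceOf D
  S₂ = spaceOf D₂

  S-um : UltrametricSpace S
  S-um = record { nbhd-refl = refl ; nbhd-sym = sym ; nbhd-trans = trans ; nbhd-mono = r-mono }

  D₂-nbhd : ∀ n {A B} u v → D₂.r (A , u) n ≡ D₂.r (B , v) n → r A n ≡ r B n × Agree n u v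
  D₂-nbhd n {B = B} u v eq = let _ , e , a = r₂≡⁻¹ u eq in
    e , λ i i<n → trans (a i i<n) (sym (pad-restrict n v i i<n))

  nbhd-D₂ : ∀ n {A B} {u v} → r A n ≡ r B n → Agree n u v → D₂.r (A , u) n ≡ D₂.r (B , v) n
  nbhd-D₂ n e a = cong₂ (λ a p → n , a , p) e (restrict-cong a)

  S₂-um : UltrametricSpace S₂
  S₂-um = record
    { nbhd-refl = refl ; nbhd-sym = sym ; nbhd-trans = trans
    ; nbhd-mono = λ { {m} {n} {_ , u} {_ , v} m≤n eq → let e , a = D₂-nbhd n u v eq in
                      nbhd-D₂ m (r-mono m≤n e) (Agree-≤ m≤n a) } }

  -- The offset k makes the first k bits irrelevant.
  index : ℕ → ℕ → ℕ
  index i j = k + square-pair i j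

  i≤index : ∀ i j → i ≤ index i j
  i≤index i j = ≤-trans (i≤square-pair i j) (m≤n+m _ k)

  index-injective : ∀ i j i′ j′ → index i j ≡ index i′ j′ → i ≡ i′ × j ≡ j′
  index-injective i j i′ j′ eq = square-pair-injective i j i′ j′ (+-cancelˡ-≡ k _ _ eq)

  Codes : (ℕ → Bool) → (ℕ → ℕ) → Set
  Codes u y = ∀ i → u (index i (y i)) ≡ true

  -- The least code of `y`: it contains nothing besides the indices of `y`, so it codes `y` alone.
  code : (ℕ → ℕ) → ℕ → Bool
  code y n = does (lem (∃ λ i → n ≡ index i (y i)))

  code-Codes : ∀ y → Codes (code y) y
  code-Codes y i = dec-true (lem _) (i , refl)

  code-unique : ∀ y {y′} → Codes (code y) y′ → ∀ i → y i ≡ y′ i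
  code-unique y {y′} c i with lem (∃ λ i′ → index i (y′ i) ≡ index i′ (y i′)) | c i
  ... | yes (i′ , eq) | _ with index-injective i (y′ i) i′ (y i′) eq
  ...   | refl , e = sym e

  code-false : ∀ y → Agree k (code y) (λ _ → false)
  code-false y n n<k = dec-false (lem _) λ (i , eq) →
    <-irrefl refl (≤-trans n<k (subst (k ≤_) (sym eq) (m≤m+n k _)))

  module _ {X : R → Set} {C : R × (ℕ → ℕ) → Set} (X-proj : Projection-of S X C) where

    -- Codes u is not functional, so both quantifiers are imposed: this keeps Coded
    -- as simple as C up to the Gδ condition that u codes some y.
    Coded : R × (ℕ → Bool) → Set
    Coded (A , u) = (∃ λ y → Codes u y) × (∀ y → Codes u y → C (A , y))

    Coded⇒X : ∀ A u → Coded (A , u) → X A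
    Coded⇒X A u ((y , cy) , all) = proj₂ (X-proj A) (y , all y cy)

    X⇒Coded : (∀ {p q} → Inseparable (S ×Baire) p q → C p → C q) →
              ∀ A → X A → ∃ λ u → Agree k u (λ _ → false) × Coded (A , u)
    X⇒Coded C-ext A x = let y , c = proj₁ (X-proj A) x in
      code y , code-false y , (y , code-Codes y) ,
      -- `y′` equals `y` only pointwise, hence the detour through inseparable points.
      λ y′ cy′ → C-ext (λ n → refl , λ i _ → code-unique y cy′ i) c

    -- Every play meeting all U i stays close to Coded and has a bit of every row set;
    -- for closed C this describes Coded as a Gδ set.
    U : ℕ → Σ ℕ (λ n → AR × Vec Bool n) → Set
    U i q@(l , b , p) = (∃ λ x → Coded x × D₂.r x l ≡ q) ×
                        (∃ λ j → index i j < l × pad p (index i j) ≡ true)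

    Coded⇒U : ∀ x l → Coded x → ∀ i m → ∃ λ n → m ≤ n × U i (D₂.r x (l + n))
    Coded⇒U x@(B , u) l coded@((y , cy) , _) i m =
      n , m≤m⊔n m _ , (x , coded , refl) , y i , below ,
      trans (sym (pad-restrict (l + n) u _ below)) (cy i)
      where
      n = m ⊔ suc (index i (y i))
      below : index i (y i) < l + n
      below = ≤-trans (m≤n⊔m m _) (m≤n+m n l)

    -- Suppose `u` codes `y` but `C (B , y)` fails, as witnessed up to level `m`. The obligation for
    -- row `m ⊔ M` is used only to obtain a long approximation: its bit has index at least `m ⊔ M`.
    -- That approximation is shared with some coded `(A , v)`. Splicing `y` below `m` with a
    -- sequence `y′` coded by `v` gives `y″`, still coded by `v`, so `C (A , y″)` holds although
    -- `(A , y″)` is within level `m` of `(B , y)`.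
    U⇒Coded : Closed (S ×Baire) C → ∀ x l → (∀ i → ∃ λ n → U i (D₂.r x (l + n))) → Coded x
    U⇒Coded C-closed x@(B , u) l visits = (y₀ , cy₀) , λ y cy → by-contradiction (absurd y cy)
      where
      y₀ : ℕ → ℕ
      y₀ i = proj₁ (proj₂ (proj₂ (visits i)))
      cy₀ : Codes u y₀
      cy₀ i = let n , _ , j , below , eq = visits i in trans (pad-restrict (l + n) u _ below) eq
      absurd : ∀ y → Codes u y → ¬ ¬ C (B , y)
      absurd y cy ¬c with C-closed (B , y) ¬c
      ... | m , out with bounded (λ i → index i (y i)) m
      ... | M , below with visits (m ⊔ M)
      ... | n , ((A , v) , ((y′ , cy′) , all) , eq) , j , index< , _ with D₂-nbhd (l + n) v u eq
      ... | e , agree = out (A , y″) (r-mono m≤ (sym e) , λ i i<m → sym (y″-below i i<m)) (all y″ cy″)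
        where
        large : m ⊔ M ≤ l + n
        large = ≤-trans (i≤index (m ⊔ M) j) (<⇒≤ index<)
        m≤ : m ≤ l + n
        m≤ = ≤-trans (m≤m⊔n m M) large
        y″ : ℕ → ℕ
        y″ i with i <? m
        ... | yes _ = y i
        ... | no  _ = y′ i
        y″-below : ∀ i → i < m → y″ i ≡ y i
        y″-below i i<m with i <? m
        ... | yes _  = refl
        ... | no i≮m = ⊥-elim (i≮m i<m)
        cy″ : Codes v y″
        cy″ i with i <? m
        ... | yes i<m = trans (agree _ (≤-trans (below i i<m) (≤-trans (m≤n⊔m m M) large))) (cy i)
        ... | no _    = cy′ i

    -- The complement consists of the `(A , u)` such that some row of `u` is empty or some `y` coded
    -- by `u` lies in the complement `Q` of `C`. Both alternatives are existential, so one sequence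
    -- `w` can witness either of them.
    Coded-Pi : ∀ n → Pi n (S ×Baire) C → Pi n S₂ Coded
    Coded-Pi n (Q , q-sig , C-iff) with Sigma⇒Matrix n q-sig
    ... | K , k-mat , Q-iff = NotCoded , not-coded-sigma , λ (A , u) →
      (λ ((y , cy) , all) → λ
        { (inj₁ (i , none)) → true≢false (trans (sym (cy i)) (none (y i)))
        ; (inj₂ (y′ , cy′ , q)) → proj₁ (C-iff (A , y′)) (all y′ cy′) q }) ,
      λ ¬not → decode A u (¬not ∘ inj₁) , λ y cy → proj₂ (C-iff (A , y)) (λ q → ¬not (inj₂ (y , cy , q)))
      where
      true≢false : true ≢ false
      true≢false ()

      NotCoded : R × (ℕ → Bool) → Set
      NotCoded (A , u) = (∃ λ i → ∀ j → u (index i j) ≡ false) ⊎ (∃ λ y → Codes u y × Q (A , y))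

      decode : ∀ A u → ¬ (∃ λ i → ∀ j → u (index i j) ≡ false) → ∃ λ y → Codes u y
      decode A u ¬none = (λ i → proj₁ (digit i)) , λ i → proj₂ (digit i)
        where
        ≢false⇒≡true : ∀ {b} → b ≢ false → b ≡ true
        ≢false⇒≡true {true}  _ = refl
        ≢false⇒≡true {false} ≢ = ⊥-elim (≢ refl)
        digit : ∀ i → ∃ λ j → u (index i j) ≡ true
        digit i = let j , ≢ = ¬∀⇒∃¬ (λ none → ¬none (i , none)) in j , ≢false⇒≡true ≢

      even odd : (ℕ → ℕ) → ℕ → ℕ
      even w i = w (i + i)
      odd  w i = w (suc (i + i))

      -- The even half of `w` is the coded sequence and the odd half the witness for `Q`, so two
      -- existential quantifiers merge into one.
      f : Space.Pt (S₂ ×Baire) → Space.Pt ((S ×Baire) ×Baire)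
      f ((A , u) , w) = (A , even w) , odd w

      f-continuous : Continuous (S₂ ×Baire) ((S ×Baire) ×Baire) f
      f-continuous ((A , u) , w) n = suc (n + n) , λ ((B , v) , w′) (eq , ww′) →
        let e , _ = D₂-nbhd (suc (n + n)) u v eq in
        (r-mono (≤-trans (m≤m+n n n) (n≤1+n _)) e ,
         λ i i<n → ww′ (i + i) (≤-trans (+-mono-< i<n i<n) (n≤1+n _))) ,
        λ i i<n → ww′ (suc (i + i)) (s≤s (+-mono-< i<n i<n))

      F G : Space.Pt (S₂ ×Baire) → Set
      F ((A , u) , w) = ∀ j → u (index (w 0) j) ≡ false
      G ((A , u) , w) = Codes u (even w)

      F-closed : Closed (S₂ ×Baire) F
      F-closed ((A , u) , w) ¬F = let j , ≢ = ¬∀⇒∃¬ ¬F ; m = suc (index (w 0) j) in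
        m , λ ((B , v) , w′) (eq , ww′) F′ →
          ≢ (trans (proj₂ (D₂-nbhd m u v eq) _ ≤-refl)
              (trans (cong (λ i → v (index i j)) (ww′ 0 (s≤s z≤n))) (F′ j)))

      G-closed : Closed (S₂ ×Baire) G
      G-closed ((A , u) , w) ¬G =
        let i , ≢ = ¬∀⇒∃¬ ¬G
            l = index i (even w i)
            m = suc l ⊔ suc (i + i) in
        m , λ ((B , v) , w′) (eq , ww′) G′ →
          ≢ (trans (proj₂ (D₂-nbhd m u v eq) l (m≤m⊔n (suc l) (suc (i + i))))
              (trans (cong (λ j → v (index i j)) (ww′ (i + i) (m≤n⊔m (suc l) (suc (i + i))))) (G′ i)))

      not-coded-sigma : Sigma n S₂ NotCoded
      not-coded-sigma = Matrix⇒Sigma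
        (Matrix-combine (×Baire-ultrametric S₂-um) f-continuous F-closed G-closed k-mat)
        λ (A , u) →
          (λ { (inj₁ (i , none)) → (λ _ → i) , inj₁ none
             ; (inj₂ (y , cy , q)) →
                 let z , c = proj₁ (Q-iff (A , y)) q ; w = interleave y z in
                 w , inj₂ ((λ i → subst (λ j → u (index i j) ≡ true) (sym (interleave-even y z i)) (cy i)) ,
                   Matrix-ext (×Baire-ultrametric (×Baire-ultrametric S-um)) k-mat
                     (λ _ → (refl , λ i _ → sym (interleave-even y z i)) ,
                            λ i _ → sym (interleave-odd y z i)) c) }) ,
          λ { (w , inj₁ none) → inj₁ (w 0 , none)
            ; (w , inj₂ (cw , c)) → inj₂ (even w , cw , proj₂ (Q-iff (A , even w)) (odd w , c)) }

-- Kastanas Ramsey subsets of R from games on the product.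

theorem4p5 : ((P : Set) → Dec P) →
    (D : WA2Data) → IsWA2 D → Countable (WA2Data.AR D) →
    (∀ X → Analytic (spaceOf D) X → Notions.KastanasRamsey D X)
    × (∀ (n : ℕ) →
    (∀ Y → Pi n (spaceOf (prodData D)) Y → Notions.KastanasRamsey (prodData D) Y) →
    ∀ X → Sigma (suc n) (spaceOf D) X → Notions.KastanasRamsey D X)
theorem4p5 lem D isWA2 _ = analytic , projective
  where
  open WA2Data D
  open Notions D
  open IsWA2 isWA2 using (A3-1) renaming (≤-refl to ≤R-refl)
  open Topology lem
  open Projection lem D isWA2
  open Game lem D

  search : ∀ A a n → (∃ λ m → IsDepth A a m) ⊎ (∀ m → a ≤fin r A m → n ≤ m)
  search A a zero    = inj₂ (λ _ _ → z≤n)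
  search A a (suc n) with search A a n | lem (a ≤fin r A n)
  ... | inj₁ found | _      = inj₁ found
  ... | inj₂ least | yes a≤ = inj₁ (n , a≤ , least)
  ... | inj₂ least | no a≰  = inj₂ λ m a≤ →
    ≤∧≢⇒< (least m a≤) (λ { refl → a≰ a≤ })

  depth : ∀ A a n → a ≤fin r A n → ∃ λ m → IsDepth A a m
  depth A a n a≤ = [ (λ found → found) , (λ least → ⊥-elim (<-irrefl refl (least n a≤))) ]′
    (search A a (suc n))

  ARup⇒Cube : ∀ A a → ARup A a → ∃ λ B → Cube a A B
  ARup⇒Cube A a (_ , n , a≤) = let m , isDepth = depth A a n a≤ in
    A3-1 a A m isDepth A (≤R-refl A , m , refl)

  module _ (k : ℕ) where
    open Coding lem D isWA2 k public

  module Unfolding (X : R → Set) (C : R × (ℕ → ℕ) → Set) (X-proj : Projection-of (spaceOf D) X C)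
              (C-ext : ∀ {p q} → Inseparable (spaceOf D ×Baire) p q → C p → C q)
              {k : ℕ} {a : AR} (ia : InAR k a) where

    p₀ : Vec Bool k
    -- The initial bits are `false` because `code` vanishes below `k`.
    p₀ = restrict (λ _ → false) k

    Y : R × (ℕ → Bool) → Set
    Y = Coded k X-proj

    unfold : ∀ B v → G₂.WinI (λ x → ¬ Y x) ((k , a , p₀) , (B , v)) ⊎
                     G₂.WinII Y ((k , a , p₀) , (B , v)) →
             ∃ (IWins (λ A → ¬ X A) a B) ⊎ ∃ (IIWins X a B)
    unfold B v (inj₁ W) = inj₁ (WinI⇒strategy (project-I ia
      (λ A x → let u , agree , coded = X⇒Coded k X-proj C-ext A x in
        u , (λ i i<k → trans (agree i i<k) (pad-restrict k (λ _ → false) i i<k)) , coded) W))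
    unfold B v (inj₂ W) = inj₂ (WinII⇒strategy (project-II ia (Coded⇒X k X-proj) W))

  analytic : ∀ X → Analytic (spaceOf D) X → KastanasRamsey X
  analytic X (C , C-closed , X-proj) A a up@((k , ia) , _) =
    let B , cube = ARup⇒Cube A a up in
    -- Determinacy holds at every position, so the first element found in [a,A] will do; its bits
    -- are arbitrary because the order ignores them.
    B , cube , unfold B (λ _ → false) (determined
      (λ x l _ → Coded⇒U k X-proj x l) (λ x l _ → U⇒Coded k X-proj C-closed x l))
    where
    open Unfolding X C X-proj (Closed-ext (×Baire-ultrametric (S-um k)) C-closed) ia
    open G₂.Determinacy (U k X-proj)

  projective : ∀ n → (∀ Y → Pi n (spaceOf D₂) Y → N₂.KastanasRamsey Y) →
               ∀ X → Sigma (suc n) (spaceOf D) X → KastanasRamsey X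
  projective n hyp X (C , C-pi , X-proj) A a ((k , ia) , a≤) =
    let (B , v) , cube , strategy = hyp Y (Coded-Pi k X-proj n C-pi) (A , λ _ → false) (k , a , p₀)
                                      ((k , InAR₂ ia) , a≤)
    in B , proj₁ (Cube₂⁻¹ (λ _ → false) v cube) ,
       unfold B v ([ inj₁ ∘ G₂.strategy⇒WinI , inj₂ ∘ G₂.strategy⇒WinII ]′ strategy)
    where
    open Unfolding X C X-proj (Pi-ext n (×Baire-ultrametric (S-um k)) C-pi) ia
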